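{- Let $N\ge 3$, $1\le r\le N$, let $R$ be a set of $r$ rim vertices of the wheel graph $W_{N+1}$, and let $d_1,\ldots,d_r$ be the cyclic intervals of $R$. Then $$\mathcal F_{W_{N+1}}(R)=\sum_{i=1}^{r}m^*(C_{2d_i})\prod_{\substack{1\le j\le r\\ j\ne i}}m(P_{2d_j-1}),$$ where $m(P_n)$ is the number of matchings of the path graph $P_n$ on $n$ vertices and $m^*(C_{2d})$ is the number of imperfect matchings of the cycle graph $C_{2d}$ (with the convention $m^*(C_2)=1$).
   Context: The wheel graph $W_{N+1}$ ($N\ge3$) has vertex set $\{c,v_1,\ldots,v_N\}$ and edges $\{v_i,v_{i+1}\}$ (indices modulo $N$) and $\{c,v_i\}$ for $1\le i\le N$; $c$ is the central vertex and the $v_i$ are the rim vertices. For a set $R=\{v_{a_1},\ldots,v_{a_r}\}$ of rim vertices with $1\le a_1<\cdots<a_r\le N$, the cyclic intervals are $d_i=a_{i+1}-a_i$ for $1\le i\le r-1$ and $d_r=a_1+N-a_r$. For a finite connected graph $G$ and $\varnothing\ne R\subseteq V(G)$, a rooted spanning forest of $G$ with root set $R$ is a spanning forest (an acyclic subgraph containing all vertices of $G$) in which each connected component contains exactly one vertex of $R$; $\mathcal F_G(R)$ denotes the number of such forests. A matching of a graph is a set of edges no two of which share an endpoint; the empty set is a matching. A matching is perfect if it covers all vertices, and imperfect otherwise. $C_2$ is regarded as a $2$-cycle with two parallel edges between two vertices, so $m^*(C_2)=1$. -}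

module Defs where

open import Data.Fin as Fin using (Fin; zero; suc; toℕ; inject₁; fromℕ<)
open import Data.Fin.Properties using (_≟_; any?; all?; injective⇒≤; toℕ-fromℕ<)
open import Data.Fin.Relation.Unary.Top using (view; ‵fromℕ; ‵inject₁)
open import Data.Fin.Subset using (Subset; _∈_; inside; outside)
open import Data.Fin.Subset.Properties using (_∈?_)
open import Data.List using (List; []; _∷_; _++_; map; length; filter; allFin)
open import Data.Nat using (ℕ; zero; suc; _+_; _*_; _∸_; _<_; s≤s)
open import Data.Nat.DivMod using (_mod_)
open import Data.Nat.ListAction using (sum; product)
open import Data.Product using (∃; ∃!; ∃-syntax; _×_; _,_; proj₁; proj₂)
open import Data.Product.Properties using (≡-dec)
open import Data.Sum using (_⊎_; inj₁; inj₂; [_,_]′)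
open import Data.Vec as Vec using (Vec; lookup; tabulate; here; there)
open import Data.Vec.Properties using (lookup∘tabulate)
open import Function using (_∘_)
open import Function.Definitions using (Injective)
open import Relation.Binary.Construct.Closure.ReflexiveTransitive using (Star; ε; _◅_; _◅◅_; gmap)
open import Relation.Binary.PropositionalEquality using (_≡_; _≢_; refl; sym; trans; cong; subst; subst₂)
open import Relation.Nullary using (Dec; ¬_)
open import Relation.Nullary.Decidable using (map′; _×-dec_; _⊎-dec_; _→-dec_; ¬?)
open import Relation.Unary using (Pred; Decidable)
open import Level using (0ℓ)

-- Edges are indexed rather than given as vertex pairs, so that parallel edges
-- (as in the 2-cycle) are distinct.  The order of the pair `ends e` is
-- immaterial: it is only used through `Joins` and `_isEndOf_`.
record Graph : Set where
  field
    order : ℕ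
    size  : ℕ
    ends  : Fin size → Fin order × Fin order

  Vertex Edge EdgeSet VertexSet : Set
  Vertex    = Fin order
  Edge      = Fin size
  EdgeSet   = Subset size
  VertexSet = Subset order

  Joins : Edge → Vertex → Vertex → Set
  Joins e u v = ends e ≡ (u , v) ⊎ ends e ≡ (v , u)

  _isEndOf_ : Vertex → Edge → Set
  v isEndOf e = v ≡ proj₁ (ends e) ⊎ v ≡ proj₂ (ends e)

  joins? : ∀ e u v → Dec (Joins e u v)
  joins? e u v = ≡-dec _≟_ _≟_ (ends e) (u , v) ⊎-dec ≡-dec _≟_ _≟_ (ends e) (v , u)

  isEndOf? : ∀ v e → Dec (v isEndOf e)
  isEndOf? v e = (v ≟ proj₁ (ends e)) ⊎-dec (v ≟ proj₂ (ends e))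

next : ∀ {n} → Fin n → Fin n
next {suc n} i = suc (toℕ i) mod suc n

allSubsets : ∀ n → List (Subset n)
allSubsets zero    = Vec.[] ∷ []
allSubsets (suc n) = map (Vec._∷_ outside) (allSubsets n) ++ map (Vec._∷_ inside) (allSubsets n)

#Subsets : ∀ {n} {P : Pred (Subset n) 0ℓ} → Decidable P → ℕ
#Subsets {n} P? = length (filter P? (allSubsets n))

module _ (G : Graph) where
  open Graph G

  -- A spanning subgraph (V(G) , F) is given by its edge set F.

  Adjacent : EdgeSet → Vertex → Vertex → Set
  Adjacent F u v = ∃[ e ] (e ∈ F × Joins e u v)

  Connected : EdgeSet → Vertex → Vertex → Set
  Connected F = Star (Adjacent F)

  -- A cycle u₀ e₀ u₁ e₁ … u_k e_k u₀ with distinct vertices and distinct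
  -- edges; k = 0 is a loop and k = 1 a pair of parallel edges.
  record IsCycle (F : EdgeSet) {k : ℕ} (u : Fin (suc k) → Vertex) (e : Fin (suc k) → Edge) : Set where
    constructor isCycle
    field
      vertices-distinct : Injective _≡_ _≡_ u
      edges-distinct    : Injective _≡_ _≡_ e
      edges-in          : ∀ i → e i ∈ F
      edges-join        : ∀ i → Joins (e i) (u i) (u (next i))

  HasCycle : EdgeSet → Set
  HasCycle F = ∃[ k ] ∃[ u ] ∃[ e ] IsCycle F {k} u e

  Acyclic : EdgeSet → Set
  Acyclic F = ¬ HasCycle F

  -- Each component is the component of some vertex v, and v's component
  -- contains exactly one root.
  record IsRootedSpanningForest (R : VertexSet) (F : EdgeSet) : Set where
    constructor isRootedSpanningForest
    field
      acyclic     : Acyclic F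
      unique-root : ∀ v → ∃! _≡_ (λ ρ → ρ ∈ R × Connected F v ρ)

  IsMatching : EdgeSet → Set
  IsMatching M = ∀ e f → e ∈ M → f ∈ M → e ≢ f → ¬ (∃[ v ] (v isEndOf e × v isEndOf f))

  IsPerfect : EdgeSet → Set
  IsPerfect M = ∀ v → ∃[ e ] (e ∈ M × v isEndOf e)

  IsImperfectMatching : EdgeSet → Set
  IsImperfectMatching M = IsMatching M × ¬ IsPerfect M

anyVec? : ∀ {n} k {P : Pred (Vec (Fin n) k) 0ℓ} → Decidable P → Dec (∃ P)
anyVec? zero    P? = map′ (Vec.[] ,_) (λ { (Vec.[] , p) → p }) (P? Vec.[])
anyVec? (suc k) P? =
  map′ (λ { (x , xs , p) → x Vec.∷ xs , p }) (λ { (x Vec.∷ xs , p) → x , xs , p })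
       (any? (λ x → anyVec? k (λ xs → P? (x Vec.∷ xs))))

injective? : ∀ {k n} (f : Fin k → Fin n) → Dec (∀ x y → f x ≡ f y → x ≡ y)
injective? f = all? (λ x → all? (λ y → (f x ≟ f y) →-dec (x ≟ y)))

connected? : ∀ G F u v → Dec (Connected G F u v)
connected? G F u v = go ends F u v
  where
  open Graph G

  graph : ∀ {m} → (Fin m → Vertex × Vertex) → Graph
  graph es = record { order = order ; size = _ ; ends = es }

  Conn : ∀ {m} → (Fin m → Vertex × Vertex) → Subset m → Vertex → Vertex → Set
  Conn es = Connected (graph es)

  weaken : ∀ {m} {es : Fin (suc m) → Vertex × Vertex} {F s u v} →
           Conn (es ∘ suc) F u v → Conn es (s Vec.∷ F) u v
  weaken = gmap (λ x → x) (λ { (e , e∈F , j) → suc e , there e∈F , j })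

  skip : ∀ {m} {es : Fin (suc m) → Vertex × Vertex} {F u v} →
         Conn es (outside Vec.∷ F) u v → Conn (es ∘ suc) F u v
  skip = gmap (λ x → x) (λ { (suc e , there e∈F , j) → e , e∈F , j })

  Via : ∀ {m} → (Fin (suc m) → Vertex × Vertex) → Subset m → Vertex → Vertex → Set
  Via es F u v =
    Conn (es ∘ suc) F u v ⊎
    (Conn (es ∘ suc) F u (proj₁ (es zero)) × Conn (es ∘ suc) F (proj₂ (es zero)) v) ⊎
    (Conn (es ∘ suc) F u (proj₂ (es zero)) × Conn (es ∘ suc) F (proj₁ (es zero)) v)

  fromVia : ∀ {m} {es : Fin (suc m) → Vertex × Vertex} {F u v} →
            Via es F u v → Conn es (inside Vec.∷ F) u v
  fromVia (inj₁ p)              = weaken p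
  fromVia (inj₂ (inj₁ (p , q))) = weaken p ◅◅ (zero , here , inj₁ refl) ◅ weaken q
  fromVia (inj₂ (inj₂ (p , q))) = weaken p ◅◅ (zero , here , inj₂ refl) ◅ weaken q

  toVia : ∀ {m} {es : Fin (suc m) → Vertex × Vertex} {F u v} →
          Conn es (inside Vec.∷ F) u v → Via es F u v
  toVia ε = inj₁ ε
  toVia ((suc e , there e∈F , j) ◅ p) with toVia p
  ... | inj₁ q              = inj₁ ((e , e∈F , j) ◅ q)
  ... | inj₂ (inj₁ (q , r)) = inj₂ (inj₁ ((e , e∈F , j) ◅ q , r))
  ... | inj₂ (inj₂ (q , r)) = inj₂ (inj₂ ((e , e∈F , j) ◅ q , r))
  toVia {es = es} {F} {u} {v} (_◅_ {j = w} (zero , here , inj₁ eq) p)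
    rewrite sym (cong proj₁ eq) | sym (cong proj₂ eq) with toVia p
  ... | inj₁ q              = inj₂ (inj₁ (ε , q))
  ... | inj₂ (inj₁ (q , r)) = inj₂ (inj₁ (ε , r))
  ... | inj₂ (inj₂ (q , r)) = inj₁ r
  toVia {es = es} {F} {u} {v} (_◅_ {j = w} (zero , here , inj₂ eq) p)
    rewrite sym (cong proj₁ eq) | sym (cong proj₂ eq) with toVia p
  ... | inj₁ q              = inj₂ (inj₂ (ε , q))
  ... | inj₂ (inj₁ (q , r)) = inj₁ r
  ... | inj₂ (inj₂ (q , r)) = inj₂ (inj₂ (ε , r))

  go : ∀ {m} (es : Fin m → Vertex × Vertex) F u v → Dec (Conn es F u v)
  go es Vec.[] u v = map′ (λ { refl → ε }) (λ { ε → refl ; ((() , _) ◅ _) }) (u ≟ v)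
  go es (outside Vec.∷ F) u v = map′ weaken skip (go (es ∘ suc) F u v)
  go es (inside Vec.∷ F) u v = map′ fromVia toVia
    (go (es ∘ suc) F u v ⊎-dec
     ((go (es ∘ suc) F u (proj₁ (es zero)) ×-dec go (es ∘ suc) F (proj₂ (es zero)) v) ⊎-dec
      (go (es ∘ suc) F u (proj₂ (es zero)) ×-dec go (es ∘ suc) F (proj₁ (es zero)) v)))

module _ (G : Graph) where
  open Graph G

  isCycle? : ∀ F {k} (u : Fin (suc k) → Vertex) (e : Fin (suc k) → Edge) → Dec (IsCycle G F u e)
  isCycle? F u e =
    map′ (λ { (a , b , c , d) → isCycle (λ {x} {y} → a x y) (λ {x} {y} → b x y) c d })
         (λ { (isCycle a b c d) → (λ x y → a {x} {y}) , (λ x y → b {x} {y}) , c , d })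
      (injective? u ×-dec injective? e ×-dec all? (λ i → e i ∈? F)
        ×-dec all? (λ i → joins? (e i) (u i) (u (next i))))

  IsCycle-resp : ∀ {F k} {u u′ : Fin (suc k) → Vertex} {e e′ : Fin (suc k) → Edge} →
                 (∀ i → u i ≡ u′ i) → (∀ i → e i ≡ e′ i) → IsCycle G F u e → IsCycle G F u′ e′
  IsCycle-resp {F} {u′ = u′} {e′ = e′} p q (isCycle a b c d) = isCycle
    (λ {x} {y} eq → a (trans (p x) (trans eq (sym (p y)))))
    (λ {x} {y} eq → b (trans (q x) (trans eq (sym (q y)))))
    (λ i → subst (_∈ F) (q i) (c i))
    (λ i → subst (λ f → Joins f (u′ i) (u′ (next i))) (q i) (subst₂ (Joins _) (p i) (p (next i)) (d i)))

  hasCycle? : ∀ F → Dec (HasCycle G F)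
  hasCycle? F = map′ to from
    (any? {order} (λ k → anyVec? (suc (toℕ k)) (λ us → anyVec? (suc (toℕ k)) (λ es →
      isCycle? F (lookup us) (lookup es)))))
    where
    to : (∃ λ (k : Fin order) → ∃ λ us → ∃ λ es → IsCycle G F {toℕ k} (lookup us) (lookup es)) →
         HasCycle G F
    to (k , us , es , c) = toℕ k , lookup us , lookup es , c

    bounded : ∀ k (j : Fin order) → toℕ j ≡ k → (u : Fin (suc k) → Vertex) (e : Fin (suc k) → Edge) →
              IsCycle G F u e →
              ∃ λ (k : Fin order) → ∃ λ us → ∃ λ es → IsCycle G F {toℕ k} (lookup us) (lookup es)
    bounded _ j refl u e c = j , tabulate u , tabulate e ,
      IsCycle-resp (λ i → sym (lookup∘tabulate u i)) (λ i → sym (lookup∘tabulate e i)) c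

    from : HasCycle G F →
           ∃ λ (k : Fin order) → ∃ λ us → ∃ λ es → IsCycle G F {toℕ k} (lookup us) (lookup es)
    from (k , u , e , c) =
      bounded k (fromℕ< k<order) (toℕ-fromℕ< k<order) u e c
      where
      k<order : k < order
      k<order = injective⇒≤ (IsCycle.vertices-distinct c)

  isRootedSpanningForest? : ∀ R → Decidable (IsRootedSpanningForest G R)
  isRootedSpanningForest? R F =
    map′ (λ { (a , b) → isRootedSpanningForest a b }) (λ { (isRootedSpanningForest a b) → a , b })
      (¬? (hasCycle? F) ×-dec all? (λ v → any? (λ ρ → root? v ρ ×-dec
        map′ (λ h {ρ′} → h ρ′) (λ h ρ′ → h {ρ′}) (all? (λ ρ′ → root? v ρ′ →-dec (ρ ≟ ρ′))))))
    where
    root? : ∀ v ρ → Dec (ρ ∈ R × Connected G F v ρ)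
    root? v ρ = (ρ ∈? R) ×-dec connected? G F v ρ

  isMatching? : Decidable (IsMatching G)
  isMatching? M = all? λ e → all? λ f → (e ∈? M) →-dec ((f ∈? M) →-dec (¬? (e ≟ f) →-dec
    ¬? (any? λ v → isEndOf? v e ×-dec isEndOf? v f)))

  isPerfect? : Decidable (IsPerfect G)
  isPerfect? M = all? λ v → any? λ e → (e ∈? M) ×-dec isEndOf? v e

  isImperfectMatching? : Decidable (IsImperfectMatching G)
  isImperfectMatching? M = isMatching? M ×-dec ¬? (isPerfect? M)

𝓕 : (G : Graph) → Graph.VertexSet G → ℕ
𝓕 G R = #Subsets (isRootedSpanningForest? G R)

m : Graph → ℕ
m G = #Subsets (isMatching? G)

m* : Graph → ℕ
m* G = #Subsets (isImperfectMatching? G)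

P : ℕ → Graph
P zero    = record { order = 0 ; size = 0 ; ends = λ () }
P (suc n) = record { order = suc n ; size = n ; ends = λ i → inject₁ i , suc i }

-- C 2 has two parallel edges.
C : ℕ → Graph
C n = record { order = n ; size = n ; ends = λ i → i , next i }

-- The wheel graph on N + 1 vertices: the central vertex is `zero`, and
-- `rim i` is the rim vertex v_{toℕ i + 1}.  The first N edges form the rim.
rim : ∀ {N} → Fin N → Fin (suc N)
rim = suc

wheel : ℕ → Graph
wheel N = record
  { order = suc N
  ; size  = N + N
  ; ends  = λ e → [ (λ i → rim i , rim (next i)) , (λ i → zero , rim i) ]′ (Fin.splitAt N e)
  }

-- The vertices are numbered from 0 here instead of from 1; the shift cancels in
-- the differences.
cyclicInterval : ∀ {N r} → (Fin r → Fin N) → Fin r → ℕ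
cyclicInterval {N} {suc _} a i with view i
... | ‵fromℕ     = (toℕ (a zero) + N) ∸ toℕ (a i)
... | ‵inject₁ j = toℕ (a (suc j)) ∸ toℕ (a (inject₁ j))

∑ : ∀ {r} → (Fin r → ℕ) → ℕ
∑ {r} f = sum (map f (allFin r))

∏-except : ∀ {r} → Fin r → (Fin r → ℕ) → ℕ
∏-except {r} i f = product (map f (filter (λ j → ¬? (j ≟ i)) (allFin r)))

{-# OPTIONS --safe #-}
-- A forest rooted at R is the same as a map sending each vertex outside R to its
-- parent such that iterated parents reach R.  On the wheel the parent of a rim
-- vertex is its left neighbour, its right neighbour or the centre, and the parent
-- of the centre is a rim vertex z whose root must be reached along the rim.  Once
-- each left/right letter carries a flag saying whether its root is reached along
-- the rim, admissibility of the letters is a condition on neighbours only, so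
-- the stretches between consecutive roots can be counted independently: a stretch
-- of d rim edges admits m(P_{2d-1}) words, and m*(C_{2d}) words in which z is
-- marked.  Both identities come from comparing linear recursions in d; the
-- imperfect matchings of an even cycle are all its matchings but two.
module Submission where

open import Defs
open import Data.Bool using (Bool; true; false; not; _∧_; _xor_; if_then_else_)
import Data.Bool.Properties as Bool
open import Data.Empty using (⊥)
open import Data.Fin as Fin using (Fin; zero; suc; toℕ; inject₁; fromℕ; splitAt; _↑ˡ_; _↑ʳ_)
open import Data.Fin.Properties as Fin using
  (toℕ-injective; toℕ-fromℕ<; toℕ<n; toℕ-inject₁; toℕ-fromℕ; any?; _≟_; splitAt-↑ˡ; splitAt-↑ʳ;
   splitAt⁻¹-↑ˡ; splitAt⁻¹-↑ʳ; ↑ˡ-injective; ↑ʳ-injective)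
open import Data.Fin.Relation.Unary.Top using (View; view; ‵fromℕ; ‵inject₁)
open import Data.Fin.Subset using (Subset; _∈_; _∉_; inside; outside)
open import Data.Fin.Subset.Properties using (_∈?_; ⊆-antisym)
open import Data.List as List using (List; []; _∷_; _++_; map; length; filter; concatMap; allFin)
open import Data.List.Membership.Propositional as List using (find; lose)
open import Data.List.Membership.Propositional.Properties
  using (∈-map⁺; ∈-map⁻; ∈-concatMap⁺; ∈-concatMap⁻; ∈-++⁺ˡ; ∈-++⁺ʳ; ∈-++⁻; ∈-filter⁺; ∈-filter⁻; ∈-∃++)
open import Data.List.Properties using (length-++; length-map; map-cong; map-tabulate; filter-++; filter-≐)
open import Data.List.Relation.Unary.All as All using ([]; _∷_)
import Data.List.Relation.Unary.All.Properties as All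
open import Data.List.Relation.Unary.AllPairs using ([]; _∷_)
open import Data.List.Relation.Unary.Any using (here; there)
open import Data.List.Relation.Unary.Unique.Propositional using (Unique)
import Data.List.Relation.Unary.Unique.Propositional.Properties as Unique
open import Data.Nat using (ℕ; zero; suc; _+_; _*_; _∸_; _≤_; _<_; z≤n; s≤s; NonZero)
open import Data.Nat.DivMod using (_%_; _mod_; m%n%n≡m%n; m%n<n; m<n⇒m%n≡m; n%n≡0; [m+n]%n≡m%n; %-distribˡ-+)
open import Data.Nat.ListAction using (sum; product)
open import Data.Nat.Properties as ℕ using
  (≤-refl; ≤-trans; <⇒≤; <-irrefl; ≤-total; n<1+n; +-suc; +-identityʳ; *-distribʳ-+)
open import Data.Nat.Tactic.RingSolver using (solve-∀)
open import Data.Product using (∃; ∃-syntax; _×_; _,_; proj₁; proj₂)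
open import Data.Sum using (_⊎_; inj₁; inj₂; [_,_]′)
open import Data.Vec as Vec using (Vec; []; _∷_; lookup; tabulate)
import Data.Vec.Functional as VF
open import Data.Vec.Properties
  using (∷-injectiveʳ; lookup∘tabulate; tabulate∘lookup; tabulate-cong; lookup⇒[]=; []=⇒lookup)
open import Function using (_∘_; id)
open import Function.Bundles using (_⇔_; Equivalence)
open import Function.Definitions using (Injective)
open import Level using (0ℓ)
open import Relation.Binary.Construct.Closure.ReflexiveTransitive using (Star; ε; _◅_; _◅◅_; gmap; reverse)
open import Relation.Binary.PropositionalEquality
open import Relation.Nullary using (Dec; yes; no; ¬_; does; contradiction)
open import Relation.Nullary.Decidable using (_×-dec_; _⊎-dec_; ¬?; dec-true)
open import Relation.Unary using (Pred; Decidable)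

-- Cyclic indices

-- The obstacle is that reaching R is a global condition. On the wheel, iterated parents can fail to
-- reach R in three ways: two neighbours point at each other, the walk runs round the whole rim, or
-- it returns to the centre. The first is excluded by forbidding a pair of adjacent letters, the
-- second by the fact that R contains a rim vertex. The third depends on the position of z, and this
-- is what the flags make local: z is admissible exactly when its own letter has flag true. No
-- forest is counted twice, because a forest determines its parent map and the parent map forces the
-- flags.
--
-- The sum in the theorem records the stretch that contains z, where a stretch includes the root
-- that opens it but not the one that closes it; the product comes from the other stretches.
-- Matchings are also turned into words, Boolean ones over the edges with a condition on neighbours.
-- One more letter of a stretch corresponds to two more edges of the path or cycle, which is why the
-- indices are doubled.

toℕ-mod : ∀ m n .{{_ : NonZero n}} → toℕ (m mod n) ≡ m % n
toℕ-mod m n = toℕ-fromℕ< (m%n<n m n)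

toℕ-next : ∀ {n} (i : Fin (suc n)) → toℕ (next i) ≡ suc (toℕ i) % suc n
toℕ-next {n} i = toℕ-mod (suc (toℕ i)) (suc n)

next-inject₁ : ∀ {n} (j : Fin n) → next (inject₁ j) ≡ suc j
next-inject₁ {n} j = toℕ-injective (begin
  toℕ (next (inject₁ j))         ≡⟨ toℕ-next (inject₁ j) ⟩
  suc (toℕ (inject₁ j)) % suc n  ≡⟨ cong (λ k → suc k % suc n) (toℕ-inject₁ j) ⟩
  suc (toℕ j) % suc n            ≡⟨ m<n⇒m%n≡m (s≤s (toℕ<n j)) ⟩
  suc (toℕ j)                    ∎)
  where open ≡-Reasoning

next-fromℕ : ∀ n → next (fromℕ n) ≡ zero
next-fromℕ n = toℕ-injective (begin
  toℕ (next (fromℕ n))         ≡⟨ toℕ-next (fromℕ n) ⟩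
  suc (toℕ (fromℕ n)) % suc n  ≡⟨ cong (λ k → suc k % suc n) (toℕ-fromℕ n) ⟩
  suc n % suc n                ≡⟨ n%n≡0 (suc n) ⟩
  0                            ∎)
  where open ≡-Reasoning

[m%n+o]%n≡[m+o]%n : ∀ m o n .{{_ : NonZero n}} → (m % n + o) % n ≡ (m + o) % n
[m%n+o]%n≡[m+o]%n m o n = begin
  (m % n + o) % n          ≡⟨ %-distribˡ-+ (m % n) o n ⟩
  (m % n % n + o % n) % n  ≡⟨ cong (λ x → (x + o % n) % n) (m%n%n≡m%n m n) ⟩
  (m % n + o % n) % n      ≡⟨ %-distribˡ-+ m o n ⟨
  (m + o) % n              ∎
  where open ≡-Reasoning

prev : ∀ {n} → Fin n → Fin n
prev {suc n} i = (toℕ i + n) mod suc n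

next-prev : ∀ {n} (i : Fin (suc n)) → next (prev i) ≡ i
next-prev {n} i = toℕ-injective (begin
  toℕ (next (prev i))                   ≡⟨ toℕ-next (prev i) ⟩
  suc (toℕ (prev i)) % suc n            ≡⟨ cong (_% suc n) (ℕ.+-comm 1 _) ⟩
  (toℕ (prev i) + 1) % suc n            ≡⟨ cong (λ x → (x + 1) % suc n) (toℕ-mod (toℕ i + n) (suc n)) ⟩
  ((toℕ i + n) % suc n + 1) % suc n     ≡⟨ [m%n+o]%n≡[m+o]%n (toℕ i + n) 1 (suc n) ⟩
  (toℕ i + n + 1) % suc n               ≡⟨ cong (_% suc n) (trans (ℕ.+-assoc (toℕ i) n 1) (cong (toℕ i +_) (ℕ.+-comm n 1))) ⟩
  (toℕ i + suc n) % suc n               ≡⟨ [m+n]%n≡m%n (toℕ i) (suc n) ⟩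
  toℕ i % suc n                         ≡⟨ m<n⇒m%n≡m (toℕ<n i) ⟩
  toℕ i                                 ∎)
  where open ≡-Reasoning

prev-next : ∀ {n} (i : Fin (suc n)) → prev (next i) ≡ i
prev-next {n} i = toℕ-injective (begin
  toℕ (prev (next i))                   ≡⟨ toℕ-mod (toℕ (next i) + n) (suc n) ⟩
  (toℕ (next i) + n) % suc n            ≡⟨ cong (λ x → (x + n) % suc n) (toℕ-next i) ⟩
  (suc (toℕ i) % suc n + n) % suc n     ≡⟨ [m%n+o]%n≡[m+o]%n (suc (toℕ i)) n (suc n) ⟩
  (suc (toℕ i) + n) % suc n             ≡⟨ cong (_% suc n) (sym (ℕ.+-suc (toℕ i) n)) ⟩
  (toℕ i + suc n) % suc n               ≡⟨ [m+n]%n≡m%n (toℕ i) (suc n) ⟩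
  toℕ i % suc n                         ≡⟨ m<n⇒m%n≡m (toℕ<n i) ⟩
  toℕ i                                 ∎)
  where open ≡-Reasoning

maximiser : ∀ {n} (f : Fin (suc n) → ℕ) → ∃[ i ] ∀ j → f j ≤ f i
maximiser {zero}  f = zero , λ { zero → ≤-refl }
maximiser {suc n} f with maximiser (f ∘ suc)
... | i , max with ≤-total (f zero) (f (suc i))
...   | inj₁ le = suc i , λ { zero → le ; (suc j) → max j }
...   | inj₂ ge = zero , λ { zero → ≤-refl ; (suc j) → ≤-trans (max j) ge }

least : ∀ {P : ℕ → Set} → (∀ n → Dec (P n)) → ∀ n → P n → ∃[ k ] P k × (∀ j → P j → k ≤ j)
least P? zero    p = 0 , p , λ _ _ → z≤n
least P? (suc n) p with P? 0
... | yes p₀ = 0 , p₀ , λ _ _ → z≤n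
... | no ¬p₀ with least (P? ∘ suc) n p
...   | k , pk , min = suc k , pk , λ { zero p₀ → contradiction p₀ ¬p₀ ; (suc j) pj → s≤s (min j pj) }

-- Forests and parent maps

module _ (G : Graph) where
  open Graph G

  joins-sym : ∀ {e u v} → Joins e u v → Joins e v u
  joins-sym (inj₁ p) = inj₂ p
  joins-sym (inj₂ p) = inj₁ p

  joins-unique : ∀ {e u v x y} → Joins e u v → Joins e x y → (u ≡ x × v ≡ y) ⊎ (u ≡ y × v ≡ x)
  joins-unique (inj₁ p) (inj₁ q) = inj₁ (cong proj₁ (trans (sym p) q) , cong proj₂ (trans (sym p) q))
  joins-unique (inj₁ p) (inj₂ q) = inj₂ (cong proj₁ (trans (sym p) q) , cong proj₂ (trans (sym p) q))
  joins-unique (inj₂ p) (inj₁ q) = inj₂ (cong proj₂ (trans (sym p) q) , cong proj₁ (trans (sym p) q))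
  joins-unique (inj₂ p) (inj₂ q) = inj₁ (cong proj₂ (trans (sym p) q) , cong proj₁ (trans (sym p) q))

  -- A simple path x₀ e₀ x₁ … x_k from v to t whose edges satisfy E; the edge
  -- list is padded with e_k = c, so that it closes up when c joins t to v.
  record SimplePath (E : Edge → Set) (c : Edge) (v t : Vertex) : Set where
    constructor simplePath
    field
      {len}    : ℕ
      x        : Fin (suc len) → Vertex
      e        : Fin (suc len) → Edge
      start    : x zero ≡ v
      end      : x (fromℕ len) ≡ t
      closing  : e (fromℕ len) ≡ c
      joins    : ∀ i → Joins (e (inject₁ i)) (x (inject₁ i)) (x (suc i))
      allowed  : ∀ i → E (e (inject₁ i))
      distinct : Injective _≡_ _≡_ x

  suffix : ∀ {E c v t} (p : SimplePath E c v t) i → SimplePath E c (SimplePath.x p i) t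
  suffix p zero = simplePath (x p) (e p) refl (end p) (closing p) (joins p) (allowed p) (distinct p)
    where open SimplePath
  suffix (simplePath {suc _} x e st en cl jo al di) (suc i) =
    suffix (simplePath (x ∘ suc) (e ∘ suc) refl en cl (jo ∘ suc) (al ∘ suc) (Fin.suc-injective ∘ di)) i

  extend : ∀ {E c u v t} f → E f → Joins f u v → (p : SimplePath E c v t) →
           ¬ (∃[ i ] SimplePath.x p i ≡ u) → SimplePath E c u t
  extend {E} {u = u} f Ef j (simplePath x e st en cl jo al di) u∉ =
    simplePath (u VF.∷ x) (f VF.∷ e) refl en cl jo′ al′ di′
    where
    jo′ : ∀ i → Joins ((f VF.∷ e) (inject₁ i)) ((u VF.∷ x) (inject₁ i)) ((u VF.∷ x) (suc i))
    jo′ zero    = subst (Joins f u) (sym st) j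
    jo′ (suc i) = jo i
    al′ : ∀ i → E ((f VF.∷ e) (inject₁ i))
    al′ zero    = Ef
    al′ (suc i) = al i
    di′ : Injective _≡_ _≡_ (u VF.∷ x)
    di′ {zero}  {zero}  _  = refl
    di′ {zero}  {suc j} eq = contradiction (j , sym eq) u∉
    di′ {suc i} {zero}  eq = contradiction (i , eq) u∉
    di′ {suc i} {suc j} eq = cong suc (di eq)

  -- The walk is rebuilt from its far end. If the vertex to be prepended already lies on the path,
  -- the path is cut back to its suffix from there.
  loopErasure : ∀ {E : Edge → Set} c {u t} → Star (λ v w → ∃[ e ] (E e × Joins e v w)) u t →
                SimplePath E c u t
  loopErasure c {u} ε =
    simplePath {len = 0} (λ _ → u) (λ _ → c) refl refl refl (λ ()) (λ ()) (λ { {zero} {zero} _ → refl })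
  loopErasure c {u} ((f , Ef , j) ◅ w) with loopErasure c w
  ... | p with any? (λ i → SimplePath.x p i ≟ u)
  ...   | yes (i , eq) = subst (λ v → SimplePath _ c v _) eq (suffix p i)
  ...   | no u∉        = extend f Ef j p u∉

  -- Loop erasure leaves a simple path that still avoids c, and c closes it. When the path is
  -- trivial, c is a loop and the cycle has k = 0.
  closedWalk⇒cycle : ∀ {F c u v} → c ∈ F → Joins c u v →
                     Star (λ x y → ∃[ e ] ((e ∈ F × e ≢ c) × Joins e x y)) v u → HasCycle G F
  closedWalk⇒cycle {F} {c} {u} {v} c∈F jc w with loopErasure c w
  ... | simplePath {k} x e st en cl jo al di = k , x , e , isCycle di e-inj e∈F e-joins
    where
    e-inj : Injective _≡_ _≡_ e
    e-inj {i} {j} eq with view i | view j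
    ... | ‵fromℕ     | ‵fromℕ     = refl
    ... | ‵fromℕ     | ‵inject₁ j′ = contradiction (trans (sym eq) cl) (proj₂ (al j′))
    ... | ‵inject₁ i′ | ‵fromℕ     = contradiction (trans eq cl) (proj₂ (al i′))
    ... | ‵inject₁ i′ | ‵inject₁ j′
      with joins-unique (jo i′) (subst (λ f → Joins f (x (inject₁ j′)) (x (suc j′))) (sym eq) (jo j′))
    ...   | inj₁ (p , _) = di p
    -- The edge would be traversed in opposite directions, giving both i′ = j′ + 1 and j′ = i′ + 1.
    ...   | inj₂ (p , q) = contradiction (begin-strict
              toℕ i′                <⟨ n<1+n (toℕ i′) ⟩
              toℕ (suc i′)          ≡⟨ cong toℕ (di q) ⟩
              toℕ (inject₁ j′)      ≡⟨ toℕ-inject₁ j′ ⟩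
              toℕ j′                <⟨ n<1+n (toℕ j′) ⟩
              toℕ (suc j′)          ≡⟨ cong toℕ (di p) ⟨
              toℕ (inject₁ i′)      ≡⟨ toℕ-inject₁ i′ ⟩
              toℕ i′                ∎) (<-irrefl refl)
      where open ℕ.≤-Reasoning
    e∈F : ∀ i → e i ∈ F
    e∈F i with view i
    ... | ‵fromℕ     = subst (_∈ F) (sym cl) c∈F
    ... | ‵inject₁ j = proj₁ (al j)
    e-joins : ∀ i → Joins (e i) (x i) (x (next i))
    e-joins i with view i
    ... | ‵fromℕ rewrite next-fromℕ k | cl | st | en = jc
    ... | ‵inject₁ j rewrite next-inject₁ j = jo j

  module _ (R : VertexSet) where

    -- Termination of the parent map as data: the derivation is the path to the root, and its length
    -- is a rank that drops strictly from a vertex to its target.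
    data Grounded (target : Vertex → Vertex) : Vertex → Set where
      root : ∀ {v} → v ∈ R → Grounded target v
      step : ∀ {v} → v ∉ R → Grounded target (target v) → Grounded target v

    depth : ∀ {t v} → Grounded t v → ℕ
    depth (root _)   = 0
    depth (step _ g) = suc (depth g)

    -- Derivations contain proofs of non-membership, so they are not compared themselves; each
    -- quantity read off a derivation is shown separately to depend on the vertex alone.
    depth-unique : ∀ {t v} (g g′ : Grounded t v) → depth g ≡ depth g′
    depth-unique (root _)     (root _)     = refl
    depth-unique (root v∈R)   (step v∉R _) = contradiction v∈R v∉R
    depth-unique (step v∉R _) (root v∈R)   = contradiction v∈R v∉R
    depth-unique (step _ g)   (step _ g′)  = cong suc (depth-unique g g′)

    rootOf : ∀ {t v} → Grounded t v → Vertex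
    rootOf {v = v} (root _) = v
    rootOf (step _ g)       = rootOf g

    rootOf-unique : ∀ {t v} (g g′ : Grounded t v) → rootOf g ≡ rootOf g′
    rootOf-unique (root _)     (root _)     = refl
    rootOf-unique (root v∈R)   (step v∉R _) = contradiction v∈R v∉R
    rootOf-unique (step v∉R _) (root v∈R)   = contradiction v∈R v∉R
    rootOf-unique (step _ g)   (step _ g′)  = rootOf-unique g g′

    rootOf∈R : ∀ {t v} (g : Grounded t v) → rootOf g ∈ R
    rootOf∈R (root v∈R) = v∈R
    rootOf∈R (step _ g) = rootOf∈R g

    -- The values of `parent` and `target` at roots are irrelevant.
    record IsParentMap (F : EdgeSet) (parent : Vertex → Edge) (target : Vertex → Vertex) : Set where
      field
        joins    : ∀ {v} → v ∉ R → Joins (parent v) v (target v)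
        parent∈F : ∀ {v} → v ∉ R → parent v ∈ F
        covers   : ∀ {e} → e ∈ F → ∃[ v ] (v ∉ R × parent v ≡ e)
        grounded : ∀ v → Grounded target v

      rank : Vertex → ℕ
      rank v = depth (grounded v)

      rank-target : ∀ {v} → v ∉ R → rank (target v) < rank v
      rank-target {v} v∉R with grounded v
      ... | root v∈R = contradiction v∈R v∉R
      ... | step _ g = s≤s (ℕ.≤-reflexive (depth-unique (grounded (target v)) g))

      joins-parent : ∀ {v x y} → v ∉ R → Joins (parent v) x y →
                     (v ≡ x × target v ≡ y) ⊎ (v ≡ y × target v ≡ x)
      joins-parent v∉R = joins-unique (joins v∉R)

      -- Distinct vertices sharing a parent edge would be each other's targets, and the rank would
      -- drop in both directions.
      parent-injective : ∀ {v w} → v ∉ R → w ∉ R → parent v ≡ parent w → v ≡ w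
      parent-injective {v} {w} v∉R w∉R eq
        with joins-parent v∉R (subst (λ e → Joins e w (target w)) (sym eq) (joins w∉R))
      ... | inj₁ (v≡w , _)  = v≡w
      ... | inj₂ (v≡tw , tv≡w) = contradiction
              (ℕ.<-trans (subst (_< rank v) (cong rank tv≡w) (rank-target v∉R))
                         (subst (_< rank w) (cong rank (sym v≡tw)) (rank-target w∉R)))
              (<-irrefl refl)

      -- Take a vertex of maximal rank on the cycle. A cycle edge at it cannot be the parent edge of
      -- the other end, since that end would then have larger rank. So both cycle edges there are
      -- its own parent edge, the cycle is a loop, and the vertex would be its own target.
      acyclic : Acyclic G F
      acyclic (k , u , e , isCycle u-inj e-inj e∈F e-joins) with maximiser (rank ∘ u)
      ... | i , max = no-loop (outgoing i (e-joins i) (max (next i)))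
                              (outgoing (prev i) (joins-sym e-joins′) (max (prev i)))
        where
        e-joins′ : Joins (e (prev i)) (u (prev i)) (u i)
        e-joins′ = subst (λ j → Joins (e (prev i)) (u (prev i)) (u j)) (next-prev i) (e-joins (prev i))
        outgoing : ∀ j {y} → Joins (e j) (u i) y → rank y ≤ rank (u i) →
                   u i ∉ R × e j ≡ parent (u i) × target (u i) ≡ y
        outgoing j jo le with covers (e∈F j)
        ... | v , v∉R , eq with joins-parent v∉R (subst (λ f → Joins f _ _) (sym eq) jo)
        ...   | inj₁ (refl , tv≡y) = v∉R , sym eq , tv≡y
        ...   | inj₂ (refl , tv≡u) =
                  contradiction (subst (_< rank v) (cong rank tv≡u) (rank-target v∉R)) (ℕ.≤⇒≯ le)
        no-loop : ∀ {y} → (u i ∉ R × e i ≡ parent (u i) × target (u i) ≡ u (next i)) →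
                  (u i ∉ R × e (prev i) ≡ parent (u i) × target (u i) ≡ y) → ⊥
        no-loop (ui∉R , p , q) (_ , p′ , _) = <-irrefl (cong rank tu≡u) (rank-target ui∉R)
          where
          prev≡i : prev i ≡ i
          prev≡i = e-inj (trans p′ (sym p))
          tu≡u : target (u i) ≡ u i
          tu≡u = trans q (cong u (trans (cong next (sym prev≡i)) (next-prev i)))

      toRoot : ∀ {v} (g : Grounded target v) → Connected G F v (rootOf g)
      toRoot (root _)     = ε
      toRoot (step v∉R g) = (_ , parent∈F v∉R , joins v∉R) ◅ toRoot g

      rootOf-target : ∀ {v} → v ∉ R → rootOf (grounded v) ≡ rootOf (grounded (target v))
      rootOf-target {v} v∉R = rootOf-unique (grounded v) (step v∉R (grounded (target v)))

      -- By `covers`, every edge of F joins some vertex to its target, and these two have the same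
      -- root. This yields uniqueness of the root in a component.
      rootOf-connected : ∀ {v w} → Connected G F v w → rootOf (grounded v) ≡ rootOf (grounded w)
      rootOf-connected ε = refl
      rootOf-connected ((e , e∈F , jo) ◅ c) with covers e∈F
      ... | x , x∉R , refl with joins-parent x∉R jo
      ...   | inj₁ (refl , refl) = trans (rootOf-target x∉R) (rootOf-connected c)
      ...   | inj₂ (refl , refl) = trans (sym (rootOf-target x∉R)) (rootOf-connected c)

      forest : IsRootedSpanningForest G R F
      forest = isRootedSpanningForest acyclic λ v →
        rootOf (grounded v) , (rootOf∈R (grounded v) , toRoot (grounded v)) ,
        λ { (ρ∈R , c) → trans (rootOf-connected c) (rootOf-unique (grounded _) (root ρ∈R)) }

    -- The edge `p′ v` is, for the first map, the parent edge of v or of `t′ v`. In the second case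
    -- the induction towards the root says that `t′ v` has this edge as its parent for the second
    -- map too, and `parent-injective` identifies `t′ v` with v.
    parent-unique : ∀ {F p t p′ t′} → IsParentMap F p t → IsParentMap F p′ t′ →
                    ∀ {v} → v ∉ R → p v ≡ p′ v
    parent-unique {F} {p} {t} {p′} {t′} A B v∉R = go (IsParentMap.grounded B _) v∉R
      where
      module A = IsParentMap A
      module B = IsParentMap B
      go : ∀ {v} → Grounded t′ v → v ∉ R → p v ≡ p′ v
      go (root v∈R) v∉R = contradiction v∈R v∉R
      go {v} (step _ g) v∉R with A.covers (B.parent∈F v∉R)
      ... | x , x∉R , eq with B.joins-parent v∉R (subst (λ e → Joins e x (t x)) eq (A.joins x∉R))
      ...   | inj₁ (refl , _)    = eq
      ...   | inj₂ (_ , refl) with B.parent-injective x∉R v∉R (trans (sym (go g x∉R)) eq)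
      ...     | tv≡v = subst (λ y → p y ≡ p′ v) tv≡v eq

    module _ (F : EdgeSet) where

      -- Distance at most n from R inside F. Being cumulative in n and decidable, it lets `least`
      -- extract the exact distance.
      Near : ℕ → Vertex → Set
      Near zero    v = v ∈ R
      Near (suc n) v = Near n v ⊎ ∃[ e ] ∃[ w ] ((e ∈ F × Joins e v w) × Near n w)

      near? : ∀ n v → Dec (Near n v)
      near? zero    v = v ∈? R
      near? (suc n) v = near? n v ⊎-dec
        any? (λ e → any? (λ w → (e ∈? F ×-dec joins? e v w) ×-dec near? n w))

      connected⇒near : ∀ {v ρ} → Connected G F v ρ → ρ ∈ R → ∃[ n ] Near n v
      connected⇒near ε ρ∈R = 0 , ρ∈R
      connected⇒near ((e , e∈F , jo) ◅ c) ρ∈R with connected⇒near c ρ∈R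
      ... | n , near = suc n , inj₂ (e , _ , (e∈F , jo) , near)

      module _ (e₀ : Edge) (forest : IsRootedSpanningForest G R F) where
        open IsRootedSpanningForest forest

        nearest : ∀ v → ∃[ k ] Near k v × (∀ j → Near j v → k ≤ j)
        nearest v with unique-root v
        ... | ρ , (ρ∈R , c) , _ with connected⇒near c ρ∈R
        ...   | n , near = least (λ k → near? k v) n near

        distance : Vertex → ℕ
        distance v = proj₁ (nearest v)

        Closer : Vertex → Edge × Vertex → Set
        Closer v (e , w) = (e ∈ F × Joins e v w) × distance w < distance v

        -- At the minimal n the witness of `Near` cannot come from a smaller n, so it begins with an
        -- edge of F whose far end is one step closer.
        closer : ∀ v → v ∉ R → ∃ (Closer v)
        closer v v∉R = go (distance v) (proj₁ (proj₂ (nearest v))) (proj₂ (proj₂ (nearest v)))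
          where
          go : ∀ k → Near k v → (∀ j → Near j v → k ≤ j) →
               ∃[ s ] ((proj₁ s ∈ F × Joins (proj₁ s) v (proj₂ s)) × distance (proj₂ s) < k)
          go zero    near _   = contradiction near v∉R
          go (suc k) (inj₁ near) min = contradiction (min k near) (ℕ.<⇒≱ (n<1+n k))
          go (suc k) (inj₂ (e , w , ew , near)) _ = (e , w) , ew , s≤s (proj₂ (proj₂ (nearest w)) k near)

        toNearest : Vertex → Edge × Vertex
        toNearest v with v ∈? R
        -- Default values, since a root has no parent.
        ... | yes _  = e₀ , v
        ... | no v∉R = proj₁ (closer v v∉R)

        toNearest-closer : ∀ {v} → v ∉ R → Closer v (toNearest v)
        toNearest-closer {v} v∉R with v ∈? R
        ... | yes v∈R = contradiction v∈R v∉R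
        ... | no v∉R′ = proj₂ (closer v v∉R′)

        par : Vertex → Edge
        par v = proj₁ (toNearest v)

        tgt : Vertex → Vertex
        tgt v = proj₂ (toNearest v)

        descend : ∀ n v → distance v ≤ n → Grounded tgt v
        descend n v le with v ∈? R
        ... | yes v∈R = root v∈R
        descend zero v le | no v∉R =
          contradiction (≤-trans (proj₂ (toNearest-closer v∉R)) le) λ ()
        descend (suc n) v le | no v∉R =
          step v∉R (descend n (tgt v) (ℕ.≤-pred (≤-trans (proj₂ (toNearest-closer v∉R)) le)))

        forest⇒parentMap : IsParentMap F par tgt
        forest⇒parentMap = record
          { joins    = λ v∉R → proj₂ (proj₁ (toNearest-closer v∉R))
          ; parent∈F = λ v∉R → proj₁ (proj₁ (toNearest-closer v∉R))
          ; covers   = covers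
          ; grounded = λ v → descend (distance v) v ≤-refl
          }
          where
          covers : ∀ {e} → e ∈ F → ∃[ v ] (v ∉ R × par v ≡ e)
          covers {e} e∈F with any? (λ v → ¬? (v ∈? R) ×-dec (par v ≟ e))
          ... | yes p = p
          -- If e were nobody's parent edge, the parent paths from its two ends would both avoid e.
          -- The ends lie in one component, so these paths lead to the same root, and e closes them
          -- up to a cycle.
          ... | no ¬p = contradiction (closedWalk⇒cycle e∈F (inj₁ refl) walk) acyclic
            where
            x y : Vertex
            x = proj₁ (ends e)
            y = proj₂ (ends e)
            avoiding : ∀ {v} (g : Grounded tgt v) →
                       Star (λ v w → ∃[ f ] ((f ∈ F × f ≢ e) × Joins f v w)) v (rootOf g)
            avoiding (root _) = ε
            avoiding {v} (step v∉R g) =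
              (par v , (proj₁ (proj₁ (toNearest-closer v∉R)) , λ eq → ¬p (v , v∉R , eq))
                     , proj₂ (proj₁ (toNearest-closer v∉R))) ◅ avoiding g
            gx : Grounded tgt x
            gx = descend _ x ≤-refl
            gy : Grounded tgt y
            gy = descend _ y ≤-refl
            forget : ∀ {v w} → Star (λ v w → ∃[ f ] ((f ∈ F × f ≢ e) × Joins f v w)) v w → Connected G F v w
            forget = gmap (λ v → v) (λ { (f , (f∈F , _) , jo) → f , f∈F , jo })
            sameRoot : rootOf gx ≡ rootOf gy
            sameRoot = trans
              (sym (proj₂ (proj₂ (unique-root x)) (rootOf∈R gx , forget (avoiding gx))))
              (proj₂ (proj₂ (unique-root x)) (rootOf∈R gy , (e , e∈F , inj₁ refl) ◅ forget (avoiding gy)))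
            walk : Star (λ v w → ∃[ f ] ((f ∈ F × f ≢ e) × Joins f v w)) y x
            walk = avoiding gy ◅◅ reverse (λ { (f , f∈ , jo) → f , f∈ , joins-sym jo })
              (subst (Star _ x) sameRoot (avoiding gx))

-- Codes of forests of the wheel

next-induction : ∀ {n} (P : Fin (suc n) → Set) {i₀} → P i₀ → (∀ i → P i → P (next i)) → ∀ i → P i
-- The number of steps from i₀ to i, increased by a full turn so that the truncated subtraction is
-- exact.
next-induction {n} P {i₀} p₀ pₛ i = subst P (toℕ-injective target) (shifted (toℕ i + suc n ∸ toℕ i₀))
  where
  open ≡-Reasoning
  shifted : ∀ k → P ((toℕ i₀ + k) mod suc n)
  shifted zero    = subst P (toℕ-injective (begin
    toℕ i₀                            ≡⟨ m<n⇒m%n≡m (toℕ<n i₀) ⟨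
    toℕ i₀ % suc n                    ≡⟨ cong (_% suc n) (ℕ.+-identityʳ (toℕ i₀)) ⟨
    (toℕ i₀ + 0) % suc n              ≡⟨ toℕ-mod (toℕ i₀ + 0) (suc n) ⟨
    toℕ ((toℕ i₀ + 0) mod suc n)      ∎)) p₀
  shifted (suc k) = subst P (toℕ-injective (begin
    toℕ (next ((toℕ i₀ + k) mod suc n))           ≡⟨ toℕ-next ((toℕ i₀ + k) mod suc n) ⟩
    suc (toℕ ((toℕ i₀ + k) mod suc n)) % suc n    ≡⟨ cong (_% suc n) (ℕ.+-comm 1 _) ⟩
    (toℕ ((toℕ i₀ + k) mod suc n) + 1) % suc n    ≡⟨ cong (λ x → (x + 1) % suc n) (toℕ-mod (toℕ i₀ + k) (suc n)) ⟩
    ((toℕ i₀ + k) % suc n + 1) % suc n            ≡⟨ [m%n+o]%n≡[m+o]%n (toℕ i₀ + k) 1 (suc n) ⟩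
    (toℕ i₀ + k + 1) % suc n
      ≡⟨ cong (_% suc n) (trans (ℕ.+-assoc (toℕ i₀) k 1) (cong (toℕ i₀ +_) (ℕ.+-comm k 1))) ⟩
    (toℕ i₀ + suc k) % suc n                      ≡⟨ toℕ-mod (toℕ i₀ + suc k) (suc n) ⟨
    toℕ ((toℕ i₀ + suc k) mod suc n)              ∎)) (pₛ _ (shifted k))
  target : toℕ ((toℕ i₀ + (toℕ i + suc n ∸ toℕ i₀)) mod suc n) ≡ toℕ i
  target = begin
    toℕ ((toℕ i₀ + (toℕ i + suc n ∸ toℕ i₀)) mod suc n) ≡⟨ toℕ-mod (toℕ i₀ + (toℕ i + suc n ∸ toℕ i₀)) (suc n) ⟩
    (toℕ i₀ + (toℕ i + suc n ∸ toℕ i₀)) % suc n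
      ≡⟨ cong (_% suc n) (ℕ.m+[n∸m]≡n (≤-trans (<⇒≤ (toℕ<n i₀)) (ℕ.m≤n+m (suc n) (toℕ i)))) ⟩
    (toℕ i + suc n) % suc n                             ≡⟨ [m+n]%n≡m%n (toℕ i) (suc n) ⟩
    toℕ i % suc n                                       ≡⟨ m<n⇒m%n≡m (toℕ<n i) ⟩
    toℕ i                                               ∎

prev-induction : ∀ {n} (P : Fin (suc n) → Set) {i₀} → P i₀ → (∀ i → P i → P (prev i)) → ∀ i → P i
prev-induction P {i₀} p₀ pₛ i =
  -- Going backwards with P is going forwards with `P j → P i`, which holds trivially at j = i.
  next-induction (λ j → P j → P i) (λ p → p)
    (λ j toP p → toP (subst P (prev-next j) (pₛ (next j) p))) i₀ p₀

does-true⁻ : ∀ {A : Set} (a? : Dec A) → does a? ≡ true → A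
does-true⁻ (yes a) _ = a

_==_ : Bool → Bool → Bool
a == b = does (a Bool.≟ b)

≡⇒== : ∀ {a b} → a ≡ b → (a == b) ≡ true
≡⇒== {a} {b} eq = dec-true (a Bool.≟ b) eq

==⇒≡ : ∀ a b → (a == b) ≡ true → a ≡ b
==⇒≡ false false _ = refl
==⇒≡ true  true  _ = refl

-- The letter of a rim vertex says where its parent lies; the flag of `left` and
-- `right` says whether the root is reached without passing through the centre.
data Letter : Set where
  stop hub   : Letter
  left right : Bool → Letter

rimRooted : Letter → Bool
rimRooted stop      = true
rimRooted hub       = false
rimRooted (left a)  = a
rimRooted (right a) = a

-- Whether the second letter may stand at the rim vertex next to that of the first.
follows : Letter → Letter → Bool
follows (right _) (left _) = false
follows (right a) l        = a == rimRooted l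
follows l         (left a) = a == rimRooted l
follows _         _        = true

module Wheel {n : ℕ} (R : Subset (suc (suc n))) (centre∉R : zero ∉ R) where

  private
    N : ℕ
    N = suc n
    W : Graph
    W = wheel N
  open Graph W

  rimEdge : Fin N → Edge
  rimEdge i = i ↑ˡ N

  spoke : Fin N → Edge
  spoke i = N ↑ʳ i

  ends-rimEdge : ∀ i → ends (rimEdge i) ≡ (rim i , rim (next i))
  ends-rimEdge i = cong [ _ , _ ]′ (splitAt-↑ˡ N i N)

  ends-spoke : ∀ i → ends (spoke i) ≡ (zero , rim i)
  ends-spoke i = cong [ _ , _ ]′ (splitAt-↑ʳ N N i)

  rimEdge≢spoke : ∀ {i j} → rimEdge i ≢ spoke j
  rimEdge≢spoke {i} {j} eq with trans (sym (ends-rimEdge i)) (trans (cong ends eq) (ends-spoke j))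
  ... | ()

  rimStep : Fin N → Letter → Edge × Vertex
  -- A default value: `stop` stands at roots, which have no parent.
  rimStep i stop      = spoke i , zero
  rimStep i hub       = spoke i , zero
  rimStep i (left _)  = rimEdge (prev i) , rim (prev i)
  rimStep i (right _) = rimEdge i , rim (next i)

  parent : (Fin N → Letter) → Fin N → Vertex → Edge
  parent ℓ z zero    = spoke z
  parent ℓ z (suc i) = proj₁ (rimStep i (ℓ i))

  target : (Fin N → Letter) → Fin N → Vertex → Vertex
  target ℓ z zero    = rim z
  target ℓ z (suc i) = proj₂ (rimStep i (ℓ i))

  isParentEdge? : ∀ ℓ z e → Dec (∃[ v ] (v ∉ R × parent ℓ z v ≡ e))
  isParentEdge? ℓ z e = any? (λ v → ¬? (v ∈? R) ×-dec (parent ℓ z v ≟ e))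

  parentEdges : (Fin N → Letter) → Fin N → EdgeSet
  parentEdges ℓ z = tabulate (does ∘ isParentEdge? ℓ z)

  ∈-parentEdges⁺ : ∀ {ℓ z v} → v ∉ R → parent ℓ z v ∈ parentEdges ℓ z
  ∈-parentEdges⁺ {ℓ} {z} {v} v∉R = lookup⇒[]= _ _
    (trans (lookup∘tabulate (does ∘ isParentEdge? ℓ z) (parent ℓ z v))
           (dec-true (isParentEdge? ℓ z (parent ℓ z v)) (v , v∉R , refl)))

  ∈-parentEdges⁻ : ∀ {ℓ z e} → e ∈ parentEdges ℓ z → ∃[ v ] (v ∉ R × parent ℓ z v ≡ e)
  ∈-parentEdges⁻ {ℓ} {z} {e} e∈ = does-true⁻ (isParentEdge? ℓ z e)
    (trans (sym (lookup∘tabulate (does ∘ isParentEdge? ℓ z) e)) ([]=⇒lookup e∈))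

  -- The conditions under which letters and z encode a forest. The field `hubward` prevents the walk
  -- from the centre through z from returning to the centre.
  record Valid (ℓ : Fin N → Letter) (z : Fin N) : Set where
    field
      stop⇒root : ∀ {i} → ℓ i ≡ stop → rim i ∈ R
      root⇒stop : ∀ {i} → rim i ∈ R → ℓ i ≡ stop
      following : ∀ i → follows (ℓ i) (ℓ (next i)) ≡ true
      hubward   : rimRooted (ℓ z) ≡ true

    followed : ∀ i → follows (ℓ (prev i)) (ℓ i) ≡ true
    followed i = subst (λ j → follows (ℓ (prev i)) (ℓ j) ≡ true) (next-prev i) (following (prev i))

    ∉root : ∀ {i l} → ℓ i ≡ l → l ≢ stop → rim i ∉ R
    ∉root eq l≢stop i∈R = l≢stop (trans (sym eq) (root⇒stop i∈R))

    left-flag : ∀ {i a} → ℓ i ≡ left a → a ≡ rimRooted (ℓ (prev i))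
    left-flag {i} eq with ℓ (prev i) | ℓ i | followed i
    left-flag refl | stop   | left a | q = ==⇒≡ a true q
    left-flag refl | hub    | left a | q = ==⇒≡ a false q
    left-flag refl | left b | left a | q = ==⇒≡ a b q

    right-flag : ∀ {i a} → ℓ i ≡ right a → a ≡ rimRooted (ℓ (next i))
    right-flag {i} eq with ℓ i | ℓ (next i) | following i
    right-flag refl | right a | stop    | q = ==⇒≡ a true q
    right-flag refl | right a | hub     | q = ==⇒≡ a false q
    right-flag refl | right a | right b | q = ==⇒≡ a b q

    ¬right-left : ∀ {i a b} → ℓ i ≡ left a → ℓ (prev i) ≢ right b
    ¬right-left {i} p q with ℓ i | ℓ (prev i) | followed i
    ¬right-left refl refl | left _ | right _ | ()

    ¬left-right : ∀ {i a b} → ℓ i ≡ right a → ℓ (next i) ≢ left b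
    ¬left-right {i} p q with ℓ i | ℓ (next i) | following i
    ¬left-right refl refl | right _ | left _ | ()

  -- The recursion measure for a run of `left` letters: the rim walk from i to a root on its left.
  -- It exists for every i because some rim vertex is a root, so the run cannot go round for ever.
  -- `After` is its mirror image.
  data Before (i : Fin N) : Set where
    here  : rim i ∈ R → Before i
    there : Before (prev i) → Before i

  data After (i : Fin N) : Set where
    here  : rim i ∈ R → After i
    there : After (next i) → After i

  module _ {ℓ z} (valid : Valid ℓ z) {i₀ : Fin N} (i₀∈R : rim i₀ ∈ R) where
    open Valid valid

    private
      G : Vertex → Set
      G = Grounded W R (target ℓ z)

    before : ∀ i → Before i
    before = next-induction Before (here i₀∈R) (λ i b → there (subst Before (sym (prev-next i)) b))

    after : ∀ i → After i
    after = prev-induction After (here i₀∈R) (λ i a → there (subst After (sym (next-prev i)) a))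

    stepTo : ∀ {i l} → ℓ i ≡ l → l ≢ stop → G (proj₂ (rimStep i l)) → G (rim i)
    stepTo {i} refl l≢stop g = step (∉root refl l≢stop) g

    -- The rim is grounded through the centre and the centre through the rim; treating the flags in
    -- turn breaks the circle. For b = true the premise `centre` is vacuous, which grounds z and
    -- hence the centre, and the centre then serves b = false.
    module _ (b : Bool) (centre : b ≡ false → G zero) where

      leftwards : ∀ {i} → Before i → ℓ i ≡ left b → G (rim i)
      leftwards (here i∈R) _ = root i∈R
      leftwards {i} (there before) eq = stepTo eq (λ ()) (go (ℓ (prev i)) refl)
        where
        go : ∀ l → ℓ (prev i) ≡ l → G (rim (prev i))
        go stop      p = root (stop⇒root p)
        go hub       p = stepTo p (λ ()) (centre (trans (left-flag eq) (cong rimRooted p)))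
        go (left a)  p = leftwards before (trans p (cong left (sym (trans (left-flag eq) (cong rimRooted p)))))
        go (right a) p = contradiction p (¬right-left eq)

      rightwards : ∀ {i} → After i → ℓ i ≡ right b → G (rim i)
      rightwards (here i∈R) _ = root i∈R
      rightwards {i} (there after) eq = stepTo eq (λ ()) (go (ℓ (next i)) refl)
        where
        go : ∀ l → ℓ (next i) ≡ l → G (rim (next i))
        go stop      p = root (stop⇒root p)
        go hub       p = stepTo p (λ ()) (centre (trans (right-flag eq) (cong rimRooted p)))
        go (left a)  p = contradiction p (¬left-right eq)
        go (right a) p = rightwards after (trans p (cong right (sym (trans (right-flag eq) (cong rimRooted p)))))

      rimGrounded : ∀ i → rimRooted (ℓ i) ≡ b → G (rim i)
      rimGrounded i p with ℓ i in eq
      ... | stop    = root (stop⇒root eq)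
      ... | hub     = stepTo eq (λ ()) (centre (sym p))
      ... | left a  = leftwards (before i) (trans eq (cong left p))
      ... | right a = rightwards (after i) (trans eq (cong right p))

    centreGrounded : G zero
    centreGrounded = step centre∉R (rimGrounded true (λ ()) z hubward)

    valid⇒joins : ∀ {v} → v ∉ R → Joins (parent ℓ z v) v (target ℓ z v)
    valid⇒joins {zero}  _ = inj₁ (ends-spoke z)
    valid⇒joins {suc i} i∉R with ℓ i in eq
    ... | stop    = contradiction (stop⇒root eq) i∉R
    ... | hub     = inj₂ (ends-spoke i)
    ... | left _  = inj₂ (trans (ends-rimEdge (prev i)) (cong (λ j → rim (prev i) , rim j) (next-prev i)))
    ... | right _ = inj₁ (ends-rimEdge i)

    valid⇒parentMap : IsParentMap W R (parentEdges ℓ z) (parent ℓ z) (target ℓ z)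
    valid⇒parentMap = record
      { joins    = valid⇒joins
      ; parent∈F = ∈-parentEdges⁺
      ; covers   = ∈-parentEdges⁻
      ; grounded = λ { zero → centreGrounded ; (suc i) → rimGrounded (rimRooted (ℓ i)) (λ _ → centreGrounded) i refl }
      }

  module _ {ℓ z ℓ′ z′} (valid : Valid ℓ z) (valid′ : Valid ℓ′ z′) {i₀ : Fin N} (i₀∈R : rim i₀ ∈ R)
           (eq : parentEdges ℓ z ≡ parentEdges ℓ′ z′) where
    private
      module V = Valid valid
      module V′ = Valid valid′
      module M = IsParentMap (valid⇒parentMap valid i₀∈R)

    sameParent : ∀ {v} → v ∉ R → parent ℓ z v ≡ parent ℓ′ z′ v
    sameParent = parent-unique W R (valid⇒parentMap valid i₀∈R)
      (subst (λ F → IsParentMap W R F (parent ℓ′ z′) (target ℓ′ z′)) (sym eq) (valid⇒parentMap valid′ i₀∈R))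

    z-injective : z ≡ z′
    z-injective = ↑ʳ-injective N z z′ (sameParent centre∉R)

    -- The common parent edge shows the kind of letter. The flag of a `left` or `right` equals that
    -- of the letter at its target, so the flags agree by recursion along the path to the root.
    ℓ-injective : ∀ i → ℓ i ≡ ℓ′ i
    ℓ-injective i = go (M.grounded (rim i)) refl
      where
      go : ∀ {v i} → Grounded W R (target ℓ z) v → v ≡ rim i → ℓ i ≡ ℓ′ i
      go (root i∈R) refl = trans (V.root⇒stop i∈R) (sym (V′.root⇒stop i∈R))
      go {i = i} (step i∉R g) refl = cases (ℓ i) (ℓ′ i) refl refl
        where
        same : ∀ {l l′} → ℓ i ≡ l → ℓ′ i ≡ l′ → proj₁ (rimStep i l) ≡ proj₁ (rimStep i l′)
        same refl refl = sameParent i∉R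
        next≢ : ∀ {l} → ℓ i ≡ l → proj₂ (rimStep i l) ≢ rim i
        next≢ refl loop = <-irrefl (cong M.rank loop) (M.rank-target i∉R)
        cases : ∀ l l′ → ℓ i ≡ l → ℓ′ i ≡ l′ → ℓ i ≡ ℓ′ i
        cases stop      l′        p q = contradiction (V.stop⇒root p) i∉R
        cases l         stop      p q = contradiction (V′.stop⇒root q) i∉R
        cases hub       hub       p q = trans p (sym q)
        cases hub       (left _)  p q = contradiction (sym (same p q)) rimEdge≢spoke
        cases hub       (right _) p q = contradiction (sym (same p q)) rimEdge≢spoke
        cases (left _)  hub       p q = contradiction (same p q) rimEdge≢spoke
        cases (right _) hub       p q = contradiction (same p q) rimEdge≢spoke
        -- The left and right rim edges coincide only when the vertex is its own neighbour, and then
        -- it would be its own target.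
        cases (left _)  (right _) p q = contradiction (cong rim (↑ˡ-injective N _ _ (same p q))) (next≢ p)
        cases (right _) (left _)  p q = contradiction
          (cong rim (trans (cong next (↑ˡ-injective N _ _ (same p q))) (next-prev i))) (next≢ p)
        cases (left a)  (left b)  p q = trans p (trans (cong left
          (trans (V.left-flag p) (trans (cong rimRooted (go g (cong (proj₂ ∘ rimStep i) p))) (sym (V′.left-flag q))))) (sym q))
        cases (right a) (right b) p q = trans p (trans (cong right
          (trans (V.right-flag p) (trans (cong rimRooted (go g (cong (proj₂ ∘ rimStep i) p))) (sym (V′.right-flag q))))) (sym q))

  module _ {F par tgt} (parentMap : IsParentMap W R F par tgt) where
    open IsParentMap parentMap

    avoidsCentre : ∀ {v} → Grounded W R tgt v → Bool
    avoidsCentre         (root _)   = true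
    avoidsCentre {zero}  (step _ _) = false
    avoidsCentre {suc _} (step _ g) = avoidsCentre g

    avoidsCentre-unique : ∀ {v} (g g′ : Grounded W R tgt v) → avoidsCentre g ≡ avoidsCentre g′
    avoidsCentre-unique         (root _)     (root _)     = refl
    avoidsCentre-unique         (root v∈R)   (step v∉R _) = contradiction v∈R v∉R
    avoidsCentre-unique         (step v∉R _) (root v∈R)   = contradiction v∈R v∉R
    avoidsCentre-unique {zero}  (step _ g)   (step _ g′)  = refl
    avoidsCentre-unique {suc _} (step _ g)   (step _ g′)  = avoidsCentre-unique g g′

    -- A path to the root through the centre contains the centre's own path. The target of the
    -- centre has smaller rank, so its path avoids the centre; this gives `hubward`.
    ¬avoidsCentre⇒rank≤ : ∀ {v} (g : Grounded W R tgt v) → avoidsCentre g ≡ false → rank zero ≤ depth W R g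
    ¬avoidsCentre⇒rank≤ {zero}  g@(step _ _) _ = ℕ.≤-reflexive (depth-unique W R (grounded zero) g)
    ¬avoidsCentre⇒rank≤ {suc _} (step _ g)   p = ℕ.m≤n⇒m≤1+n (¬avoidsCentre⇒rank≤ g p)

    flag : Vertex → Bool
    flag v = avoidsCentre (grounded v)

    flag-target : ∀ {i} → rim i ∉ R → flag (rim i) ≡ flag (tgt (rim i))
    flag-target {i} i∉R = avoidsCentre-unique (grounded (rim i)) (step i∉R (grounded (tgt (rim i))))

    -- The letter is packed with the facts about parent and target that justify it, so later proofs
    -- match on it instead of repeating the analysis of the parent edge.
    data LetterOf (i : Fin N) : Letter → Set where
      stop  : rim i ∈ R → LetterOf i stop
      hub   : rim i ∉ R → par (rim i) ≡ spoke i → tgt (rim i) ≡ zero → LetterOf i hub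
      left  : rim i ∉ R → par (rim i) ≡ rimEdge (prev i) → tgt (rim i) ≡ rim (prev i) →
              LetterOf i (left (flag (rim i)))
      right : rim i ∉ R → par (rim i) ≡ rimEdge i → tgt (rim i) ≡ rim (next i) →
              LetterOf i (right (flag (rim i)))

    letterOf : ∀ i → ∃ (LetterOf i)
    letterOf i with rim i ∈? R
    ... | yes i∈R = stop , stop i∈R
    ... | no i∉R with splitAt N (par (rim i)) in eq | joins i∉R
    ...   | inj₁ j | inj₁ q = right _ , right i∉R
            (trans (sym (splitAt⁻¹-↑ˡ eq)) (cong rimEdge j≡i)) (trans (sym (cong proj₂ q)) (cong (rim ∘ next) j≡i))
            where
            j≡i : j ≡ i
            j≡i = Fin.suc-injective (cong proj₁ q)
    ...   | inj₁ j | inj₂ q = left _ , left i∉R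
            (trans (sym (splitAt⁻¹-↑ˡ eq)) (cong rimEdge j≡prev)) (trans (sym (cong proj₁ q)) (cong rim j≡prev))
            where
            j≡prev : j ≡ prev i
            j≡prev = trans (sym (prev-next j)) (cong prev (Fin.suc-injective (cong proj₂ q)))
    ...   | inj₂ j | inj₁ q = contradiction (cong proj₁ q) λ ()
    ...   | inj₂ j | inj₂ q = hub , hub i∉R
            (trans (sym (splitAt⁻¹-↑ʳ eq)) (cong spoke (Fin.suc-injective (cong proj₂ q)))) (sym (cong proj₁ q))

    hubTarget : ∃[ z ] (par zero ≡ spoke z × tgt zero ≡ rim z)
    hubTarget with splitAt N (par zero) in eq | joins centre∉R
    ... | inj₁ _ | inj₁ q = contradiction (cong proj₁ q) λ ()
    ... | inj₁ _ | inj₂ q = contradiction (cong proj₂ q) λ ()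
    ... | inj₂ z | inj₁ q = z , sym (splitAt⁻¹-↑ʳ eq) , sym (cong proj₂ q)
    ... | inj₂ _ | inj₂ q = contradiction (cong proj₂ q) λ ()

    letters : Fin N → Letter
    letters i = proj₁ (letterOf i)

    hubChild : Fin N
    hubChild = proj₁ hubTarget

    rimRooted≡flag : ∀ {i l} → LetterOf i l → rimRooted l ≡ flag (rim i)
    rimRooted≡flag {i} (stop i∈R)     = avoidsCentre-unique (root i∈R) (grounded (rim i))
    rimRooted≡flag {i} (hub i∉R _ eq) = sym (trans (flag-target i∉R)
      (trans (cong flag eq) (avoidsCentre-unique (grounded zero) (step centre∉R (grounded (tgt zero))))))
    rimRooted≡flag (left _ _ _)       = refl
    rimRooted≡flag (right _ _ _)      = refl

    letters-follow : ∀ {i l l′} → LetterOf i l → LetterOf (next i) l′ → follows l l′ ≡ true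
    letters-follow {i} a b = go a b
      where
      toRight : ∀ {l′} → rim i ∉ R → tgt (rim i) ≡ rim (next i) → LetterOf (next i) l′ →
                (flag (rim i) == rimRooted l′) ≡ true
      toRight i∉R t b = ≡⇒== (trans (flag-target i∉R) (trans (cong flag t) (sym (rimRooted≡flag b))))
      toLeft : ∀ {l} → rim (next i) ∉ R → tgt (rim (next i)) ≡ rim (prev (next i)) → LetterOf i l →
               (flag (rim (next i)) == rimRooted l) ≡ true
      toLeft i∉R t a = ≡⇒== (trans (flag-target i∉R)
        (trans (cong flag (trans t (cong rim (prev-next i)))) (sym (rimRooted≡flag a))))
      go : ∀ {l l′} → LetterOf i l → LetterOf (next i) l′ → follows l l′ ≡ true
      -- The two neighbours would be each other's targets, against the descent of the rank.
      go (right i∉R _ t)  (left j∉R _ t′) = contradiction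
        (ℕ.<-trans (subst (_< rank (rim i)) (cong rank t) (rank-target i∉R))
                   (subst (_< rank (rim (next i))) (cong rank (trans t′ (cong rim (prev-next i)))) (rank-target j∉R)))
        (<-irrefl refl)
      go (right i∉R _ t)  b@(stop _)        = toRight i∉R t b
      go (right i∉R _ t)  b@(hub _ _ _)     = toRight i∉R t b
      go (right i∉R _ t)  b@(right _ _ _)   = toRight i∉R t b
      go a@(stop _)       (left j∉R _ t)    = toLeft j∉R t a
      go a@(hub _ _ _)    (left j∉R _ t)    = toLeft j∉R t a
      go a@(left _ _ _)   (left j∉R _ t)    = toLeft j∉R t a
      go (stop _)         (stop _)          = refl
      go (stop _)         (hub _ _ _)       = refl
      go (stop _)         (right _ _ _)     = refl
      go (hub _ _ _)      (stop _)          = refl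
      go (hub _ _ _)      (hub _ _ _)       = refl
      go (hub _ _ _)      (right _ _ _)     = refl
      go (left _ _ _)     (stop _)          = refl
      go (left _ _ _)     (hub _ _ _)       = refl
      go (left _ _ _)     (right _ _ _)     = refl

    letters-valid : Valid letters hubChild
    letters-valid = record
      { stop⇒root = λ {i} → stop⇒root (proj₂ (letterOf i))
      ; root⇒stop = λ {i} → root⇒stop (proj₂ (letterOf i))
      ; following = λ i → letters-follow (proj₂ (letterOf i)) (proj₂ (letterOf (next i)))
      ; hubward   = trans (rimRooted≡flag (proj₂ (letterOf hubChild))) (flagTrue (flag (rim hubChild)) refl)
      }
      where
      stop⇒root : ∀ {i l} → LetterOf i l → l ≡ stop → rim i ∈ R
      stop⇒root (stop i∈R) _ = i∈R
      root⇒stop : ∀ {i l} → LetterOf i l → rim i ∈ R → l ≡ stop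
      root⇒stop (stop _)        _   = refl
      root⇒stop (hub i∉R _ _)   i∈R = contradiction i∈R i∉R
      root⇒stop (left i∉R _ _)  i∈R = contradiction i∈R i∉R
      root⇒stop (right i∉R _ _) i∈R = contradiction i∈R i∉R
      flagTrue : ∀ b → flag (rim hubChild) ≡ b → b ≡ true
      flagTrue true  _  = refl
      flagTrue false eq = contradiction
        (≤-trans (subst (_< rank zero) (cong rank (proj₂ (proj₂ hubTarget))) (rank-target centre∉R))
                 (¬avoidsCentre⇒rank≤ (grounded (rim hubChild)) eq))
        (<-irrefl refl)

    letters-parent : ∀ {v} → v ∉ R → parent letters hubChild v ≡ par v
    letters-parent {zero}  _   = sym (proj₁ (proj₂ hubTarget))
    letters-parent {suc i} i∉R = go (proj₂ (letterOf i))
      where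
      go : ∀ {l} → LetterOf i l → proj₁ (rimStep i l) ≡ par (rim i)
      go (stop i∈R)    = contradiction i∈R i∉R
      go (hub _ p _)   = sym p
      go (left _ p _)  = sym p
      go (right _ p _) = sym p

    parentEdges-letters : parentEdges letters hubChild ≡ F
    parentEdges-letters = ⊆-antisym
      (λ e∈ → let v , v∉R , eq = ∈-parentEdges⁻ e∈ in
         subst (_∈ F) (trans (sym (letters-parent v∉R)) eq) (parent∈F v∉R))
      (λ e∈F → let v , v∉R , eq = covers e∈F in
         subst (_∈ parentEdges letters hubChild) (trans (letters-parent v∉R) eq) (∈-parentEdges⁺ v∉R))

-- Counting codes

-- A linear word between two boundary letters. With both boundaries equal to x it is the cyclic word
-- `x ∷ v` cut open at x; it serves for letters and for edge sets alike.
Chain : {A : Set} → (A → A → Bool) → ∀ {n} → A → Vec A n → A → Set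
Chain rel x []      y = rel x y ≡ true
Chain rel x (a ∷ v) y = rel x a ≡ true × Chain rel a v y

module _ {A : Set} (rel : A → A → Bool) where

  chain⁺ : ∀ {n} x (v : Vec A n) y →
           (∀ i → rel (lookup (x ∷ v) (inject₁ i)) (lookup v i) ≡ true) →
           rel (lookup (x ∷ v) (fromℕ n)) y ≡ true → Chain rel x v y
  chain⁺ x []      y p q = q
  chain⁺ x (a ∷ v) y p q = p zero , chain⁺ a v y (p ∘ suc) q

  chain⁻ : ∀ {n} x (v : Vec A n) y → Chain rel x v y →
           (∀ i → rel (lookup (x ∷ v) (inject₁ i)) (lookup v i) ≡ true) ×
           rel (lookup (x ∷ v) (fromℕ n)) y ≡ true
  chain⁻ x []      y q       = (λ ()) , q
  chain⁻ x (a ∷ v) y (p , c) with chain⁻ a v y c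
  ... | ps , q = (λ { zero → p ; (suc i) → ps i }) , q

  cyclic⇒chain : ∀ {n} x (v : Vec A n) →
                 (∀ i → rel (lookup (x ∷ v) i) (lookup (x ∷ v) (next i)) ≡ true) → Chain rel x v x
  cyclic⇒chain {n} x v p = chain⁺ x v x
    (λ i → subst (λ j → rel (lookup (x ∷ v) (inject₁ i)) (lookup (x ∷ v) j) ≡ true) (next-inject₁ i) (p (inject₁ i)))
    (subst (λ j → rel (lookup (x ∷ v) (fromℕ n)) (lookup (x ∷ v) j) ≡ true) (next-fromℕ n) (p (fromℕ n)))

  chain⇒cyclic : ∀ {n} x (v : Vec A n) → Chain rel x v x →
                 ∀ i → rel (lookup (x ∷ v) i) (lookup (x ∷ v) (next i)) ≡ true
  chain⇒cyclic {n} x v c i with chain⁻ x v x c | view i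
  ... | _  , q | ‵fromℕ     rewrite next-fromℕ n = q
  ... | ps , _ | ‵inject₁ j rewrite next-inject₁ j = ps j

module _ {A B : Set} (label : B → A) (f : A → List B) (label-f : ∀ {x y} → y List.∈ f x → label y ≡ x)
         (unique-f : ∀ x → Unique (f x)) where

  -- The blocks are disjoint because `label` recovers from an entry the x that produced it.
  concatMap⁺ : ∀ {xs} → Unique xs → Unique (concatMap f xs)
  concatMap⁺ []                  = []
  concatMap⁺ {x ∷ xs} (x∉xs ∷ u) = Unique.++⁺ (unique-f x) (concatMap⁺ u) λ { (y∈fx , y∈rest) →
    let x′ , x′∈xs , y∈fx′ = find (∈-concatMap⁻ f {xs = xs} y∈rest) in
    All.lookup x∉xs x′∈xs (trans (sym (label-f y∈fx)) (label-f y∈fx′)) }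

length-concatMap : {A B : Set} (f : A → List B) (xs : List A) →
                   length (concatMap f xs) ≡ sum (map (length ∘ f) xs)
length-concatMap f []       = refl
length-concatMap f (x ∷ xs) = trans (length-++ (f x)) (cong (length (f x) +_) (length-concatMap f xs))

sum-map-+ : {A : Set} (f g : A → ℕ) (xs : List A) →
            sum (map (λ x → f x + g x) xs) ≡ sum (map f xs) + sum (map g xs)
sum-map-+ f g []       = refl
sum-map-+ f g (x ∷ xs) = trans (cong (f x + g x +_) (sum-map-+ f g xs)) (interchange (f x) (g x) _ _)
  where
  interchange : ∀ a b c d → a + b + (c + d) ≡ a + c + (b + d)
  interchange = solve-∀

sum-map-* : {A : Set} (f : A → ℕ) (k : ℕ) (xs : List A) → sum (map (λ x → f x * k) xs) ≡ sum (map f xs) * k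
sum-map-* f k []       = refl
sum-map-* f k (x ∷ xs) = trans (cong (f x * k +_) (sum-map-* f k xs)) (sym (*-distribʳ-+ k (f x) _))

isStop : Letter → Bool
isStop stop = true
isStop _    = false

alphabet : Bool → List Letter
alphabet true  = stop ∷ []
alphabet false = left true ∷ left false ∷ right true ∷ right false ∷ hub ∷ []

∈-alphabet⁺ : ∀ l → l List.∈ alphabet (isStop l)
∈-alphabet⁺ stop          = here refl
∈-alphabet⁺ (left true)   = here refl
∈-alphabet⁺ (left false)  = there (here refl)
∈-alphabet⁺ (right true)  = there (there (here refl))
∈-alphabet⁺ (right false) = there (there (there (here refl)))
∈-alphabet⁺ hub           = there (there (there (there (here refl))))

∈-alphabet⁻ : ∀ {l} b → l List.∈ alphabet b → isStop l ≡ b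
∈-alphabet⁻ true  (here refl)                                 = refl
∈-alphabet⁻ false (here refl)                                 = refl
∈-alphabet⁻ false (there (here refl))                         = refl
∈-alphabet⁻ false (there (there (here refl)))                 = refl
∈-alphabet⁻ false (there (there (there (here refl))))         = refl
∈-alphabet⁻ false (there (there (there (there (here refl))))) = refl

unique-alphabet : ∀ b → Unique (alphabet b)
unique-alphabet true  = [] ∷ []
unique-alphabet false =
  ((λ ()) ∷ (λ ()) ∷ (λ ()) ∷ (λ ()) ∷ []) ∷ ((λ ()) ∷ (λ ()) ∷ (λ ()) ∷ []) ∷
  ((λ ()) ∷ (λ ()) ∷ []) ∷ ((λ ()) ∷ []) ∷ [] ∷ []

successors : Letter → Bool → List Letter
successors u b = filter (λ l → follows u l Bool.≟ true) (alphabet b)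

unique-successors : ∀ u b → Unique (successors u b)
unique-successors u b = Unique.filter⁺ (λ l → follows u l Bool.≟ true) (unique-alphabet b)

emptyWord : Letter → List (Vec Letter 0)
emptyWord u = if follows u stop then [] ∷ [] else []

bit : Bool → ℕ
bit b = if b then 1 else 0

-- P marks the positions holding `stop`.  The words occupy the positions s, s + 1, …
-- and stand between the letter u and a final `stop`.
module Words (P : ℕ → Bool) where

  words : ∀ n → ℕ → Letter → List (Vec Letter n)
  words zero    s u = emptyWord u
  words (suc n) s u = concatMap (λ l → map (l ∷_) (words n (suc s) l)) (successors u (P s))

  -- The mark is the rim vertex chosen as the parent of the centre.
  Marked : ℕ → Set
  Marked n = Vec Letter n × Fin n

  markHead : ∀ {n} → Letter → List (Vec Letter n) → List (Marked (suc n))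
  markHead l ws = if rimRooted l then map (λ w → l ∷ w , zero) ws else []

  shiftMark : ∀ {n} → Letter → Marked n → Marked (suc n)
  shiftMark l (w , k) = l ∷ w , suc k

  mutual
    markedWords : ∀ n → ℕ → Letter → List (Marked n)
    markedWords zero    s u = []
    markedWords (suc n) s u = concatMap (λ l → markedFrom l n (suc s)) (successors u (P s))

    -- Here l itself may carry the mark. With l = `stop` this is a stretch together with the root
    -- that opens it, so that z may be a root and every rim vertex belongs to one stretch.
    markedFrom : Letter → ∀ n → ℕ → List (Marked (suc n))
    markedFrom l n s = markHead l (words n s l) ++ map (shiftMark l) (markedWords n s l)

  Fits : ∀ {n} → ℕ → Vec Letter n → Set
  Fits s w = ∀ k → isStop (lookup w k) ≡ P (s + toℕ k)

  ∈-words⁺ : ∀ {n} s u (w : Vec Letter n) → Chain follows u w stop → Fits s w → w List.∈ words n s u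
  ∈-words⁺ s u [] c fits with follows u stop
  ∈-words⁺ s u [] refl fits | true = here refl
  ∈-words⁺ s u (l ∷ w) (p , c) fits = ∈-concatMap⁺ _ (lose l∈ (∈-map⁺ (l ∷_) (∈-words⁺ (suc s) l w c
    (λ k → trans (fits (suc k)) (cong P (+-suc s (toℕ k)))))))
    where
    l∈ : l List.∈ successors u (P s)
    l∈ = ∈-filter⁺ (λ l → follows u l Bool.≟ true)
      (subst (λ b → l List.∈ alphabet b) (trans (fits zero) (cong P (+-identityʳ s))) (∈-alphabet⁺ l)) p

  ∈-words⁻ : ∀ {n} s u (w : Vec Letter n) → w List.∈ words n s u → Chain follows u w stop × Fits s w
  ∈-words⁻ s u [] w∈ with follows u stop
  ... | true = refl , λ ()
  ∈-words⁻ {suc n} s u w w∈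
    with find (∈-concatMap⁻ (λ l → map (l ∷_) (words n (suc s) l)) {xs = successors u (P s)} w∈)
  ... | l , l∈ , w∈′ with ∈-map⁻ (l ∷_) w∈′ | ∈-filter⁻ (λ l → follows u l Bool.≟ true) {xs = alphabet (P s)} l∈
  ...   | v , v∈ , refl | l∈alphabet , p with ∈-words⁻ (suc s) l v v∈
  ...     | c , fits = (p , c) , λ
              { zero    → trans (∈-alphabet⁻ (P s) l∈alphabet) (cong P (sym (+-identityʳ s)))
              ; (suc k) → trans (fits k) (cong P (sym (+-suc s (toℕ k)))) }

  mutual
    ∈-markedWords⁺ : ∀ {n} s u (w : Vec Letter n) k → Chain follows u w stop → Fits s w →
                     rimRooted (lookup w k) ≡ true → (w , k) List.∈ markedWords n s u
    ∈-markedWords⁺ s u (l ∷ w) k (p , c) fits q =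
      ∈-concatMap⁺ _ (lose l∈ (∈-markedFrom⁺ (suc s) l w k c (λ k → trans (fits (suc k)) (cong P (+-suc s (toℕ k)))) q))
      where
      l∈ : l List.∈ successors u (P s)
      l∈ = ∈-filter⁺ (λ l → follows u l Bool.≟ true)
        (subst (λ b → l List.∈ alphabet b) (trans (fits zero) (cong P (+-identityʳ s))) (∈-alphabet⁺ l)) p

    ∈-markedFrom⁺ : ∀ {n} s l (w : Vec Letter n) k → Chain follows l w stop → Fits s w →
                    rimRooted (lookup (l ∷ w) k) ≡ true → (l ∷ w , k) List.∈ markedFrom l n s
    ∈-markedFrom⁺ s l w zero c fits q rewrite q = ∈-++⁺ˡ (∈-map⁺ (λ w → l ∷ w , zero) (∈-words⁺ s l w c fits))
    ∈-markedFrom⁺ {n} s l w (suc k) c fits q =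
      ∈-++⁺ʳ (markHead l (words n s l)) (∈-map⁺ (shiftMark l) (∈-markedWords⁺ s l w k c fits q))

  mutual
    ∈-markedWords⁻ : ∀ {n} s u (w : Vec Letter n) k → (w , k) List.∈ markedWords n s u →
                     w List.∈ words n s u × rimRooted (lookup w k) ≡ true
    ∈-markedWords⁻ {suc n} s u w k wk∈
      with find (∈-concatMap⁻ (λ l → markedFrom l n (suc s)) {xs = successors u (P s)} wk∈)
    ... | l , l∈ , wk∈′ with ∈-markedFrom⁻ (suc s) l w k wk∈′
    ...   | v , refl , v∈ , q = ∈-concatMap⁺ _ (lose l∈ (∈-map⁺ (l ∷_) v∈)) , q

    ∈-markedFrom⁻ : ∀ {n} s l (w : Vec Letter (suc n)) k → (w , k) List.∈ markedFrom l n s →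
                    ∃[ v ] (w ≡ l ∷ v × v List.∈ words n s l × rimRooted (lookup w k) ≡ true)
    ∈-markedFrom⁻ {n} s l w k wk∈ with ∈-++⁻ (markHead l (words n s l)) wk∈
    ... | inj₂ wk∈′ with ∈-map⁻ (shiftMark l) wk∈′
    ...   | (v , k′) , vk∈ , refl with ∈-markedWords⁻ s l v k′ vk∈
    ...     | v∈ , q = v , refl , v∈ , q
    ∈-markedFrom⁻ {n} s l w k wk∈ | inj₁ wk∈′ with rimRooted l in q
    ... | true with ∈-map⁻ (λ w → l ∷ w , zero) wk∈′
    ...   | v , v∈ , refl = v , refl , v∈ , q

  unique-words : ∀ n s u → Unique (words n s u)
  unique-words zero s u with follows u stop
  ... | true  = [] ∷ []
  ... | false = []
  unique-words (suc n) s u = concatMap⁺ Vec.head _ head-l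
    (λ l → Unique.map⁺ ∷-injectiveʳ (unique-words n (suc s) l)) (unique-successors u (P s))
    where
    head-l : ∀ {l w} → w List.∈ map (l ∷_) (words n (suc s) l) → Vec.head w ≡ l
    head-l {l} w∈ with ∈-map⁻ (l ∷_) w∈
    ... | _ , _ , refl = refl

  mutual
    unique-markedWords : ∀ n s u → Unique (markedWords n s u)
    unique-markedWords zero    s u = []
    unique-markedWords (suc n) s u = concatMap⁺ (Vec.head ∘ proj₁) _ head-l
      (λ l → unique-markedFrom l n (suc s)) (unique-successors u (P s))
      where
      head-l : ∀ {l y} → y List.∈ markedFrom l n (suc s) → Vec.head (proj₁ y) ≡ l
      head-l {l} {w , k} y∈ with ∈-markedFrom⁻ (suc s) l w k y∈
      ... | _ , refl , _ = refl

    unique-markedFrom : ∀ l n s → Unique (markedFrom l n s)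
    unique-markedFrom l n s = Unique.++⁺ unique-markHead
      (Unique.map⁺ (λ { refl → refl }) (unique-markedWords n s l)) disjoint
      where
      unique-markHead : Unique (markHead l (words n s l))
      unique-markHead with rimRooted l
      ... | true  = Unique.map⁺ (λ { refl → refl }) (unique-words n s l)
      ... | false = []
      mark-zero : ∀ {y} → y List.∈ markHead l (words n s l) → proj₂ y ≡ zero
      mark-zero y∈ with rimRooted l
      ... | true with ∈-map⁻ (λ w → l ∷ w , zero) y∈
      ...   | _ , _ , refl = refl
      disjoint : ∀ {y} → (y List.∈ markHead l (words n s l) × y List.∈ map (shiftMark l) (markedWords n s l)) → _
      disjoint (y∈ , y∈′) with ∈-map⁻ (shiftMark l) y∈′
      ... | _ , _ , refl = contradiction (mark-zero y∈) λ ()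

  length-words-suc : ∀ n s u {b} → P s ≡ b →
    length (words (suc n) s u) ≡ sum (map (λ l → length (words n (suc s) l)) (successors u b))
  length-words-suc n s u refl = trans (length-concatMap _ (successors u (P s)))
    (cong sum (map-cong (λ l → length-map (l ∷_) (words n (suc s) l)) (successors u (P s))))

  length-markedWords-suc : ∀ n s u {b} → P s ≡ b →
    length (markedWords (suc n) s u) ≡ sum (map (λ l → length (markedFrom l n (suc s))) (successors u b))
  length-markedWords-suc n s u refl = length-concatMap _ (successors u (P s))

  length-markedFrom : ∀ l n s → length (markedFrom l n s) ≡
    bit (rimRooted l) * length (words n s l) + length (markedWords n s l)
  length-markedFrom l n s = trans (length-++ (markHead l (words n s l)))
    (cong₂ _+_ length-markHead (length-map (shiftMark l) (markedWords n s l)))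
    where
    length-markHead : length (markHead l (words n s l)) ≡ bit (rimRooted l) * length (words n s l)
    length-markHead with rimRooted l
    ... | true  = trans (length-map _ (words n s l)) (sym (+-identityʳ _))
    ... | false = refl

-- The number of words of n letters without `stop` between u and a closing `stop`. Below, β counts
-- such words with a mark, and γ also lets the preceding letter carry it. A stretch of d rim edges
-- has n = d - 1.
α : ℕ → Letter → ℕ
α zero    u = bit (follows u stop)
α (suc n) u = sum (map (α n) (successors u false))

mutual
  β : ℕ → Letter → ℕ
  β zero    u = 0
  β (suc n) u = sum (map (γ n) (successors u false))

  γ : ℕ → Letter → ℕ
  γ n l = bit (rimRooted l) * α n l + β n l

module Segments (P : ℕ → Bool) where
  open Words P

  StopFree : ℕ → ℕ → Set
  StopFree s n = ∀ k → k < n → P (s + k) ≡ false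

  stopFree-tail : ∀ {s n} → StopFree s (suc n) → StopFree (suc s) n
  stopFree-tail {s} free k k<n = trans (cong P (sym (+-suc s k))) (free (suc k) (s≤s k<n))

  stopFree-head : ∀ {s n} → StopFree s (suc n) → P s ≡ false
  stopFree-head {s} free = trans (cong P (sym (+-identityʳ s))) (free 0 (s≤s z≤n))

  length-words-last : ∀ n s u → StopFree s n → length (words n s u) ≡ α n u
  length-words-last zero    s u free with follows u stop
  ... | true  = refl
  ... | false = refl
  length-words-last (suc n) s u free = trans (length-words-suc n s u (stopFree-head free))
    (cong sum (map-cong (λ l → length-words-last n (suc s) l (stopFree-tail free)) (successors u false)))

  mutual
    length-markedWords-last : ∀ n s u → StopFree s n → length (markedWords n s u) ≡ β n u
    length-markedWords-last zero    s u free = refl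
    length-markedWords-last (suc n) s u free = trans (length-markedWords-suc n s u (stopFree-head free))
      (cong sum (map-cong (λ l → length-markedFrom-last l n (suc s) (stopFree-tail free)) (successors u false)))

    length-markedFrom-last : ∀ l n s → StopFree s n → length (markedFrom l n s) ≡ γ n l
    length-markedFrom-last l n s free = trans (length-markedFrom l n s)
      (cong₂ (λ x y → bit (rimRooted l) * x + y) (length-words-last n s l free) (length-markedWords-last n s l free))

  successors-stop : ∀ u (f : Letter → ℕ) → sum (map f (successors u true)) ≡ bit (follows u stop) * f stop
  successors-stop u f with follows u stop
  ... | true  = refl
  ... | false = refl

  module _ (m : ℕ) where

    -- After a `stop` the continuation no longer depends on the earlier letters, so the count
    -- factors there: n letters, the `stop`, then m letters.
    length-words-++ : ∀ n s u → StopFree s n → P (s + n) ≡ true →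
      length (words (n + suc m) s u) ≡ α n u * length (words m (suc (s + n)) stop)
    length-words-++ zero    s u free end = trans (length-words-suc m s u (trans (cong P (sym (+-identityʳ s))) end))
      (trans (successors-stop u _) (cong (λ t → bit (follows u stop) * length (words m (suc t) stop)) (sym (+-identityʳ s))))
    length-words-++ (suc n) s u free end = begin
      length (words (suc n + suc m) s u)
        ≡⟨ length-words-suc (n + suc m) s u (stopFree-head free) ⟩
      sum (map (λ l → length (words (n + suc m) (suc s) l)) (successors u false))
        ≡⟨ cong sum (map-cong (λ l → length-words-++ n (suc s) l (stopFree-tail free) (trans (cong P (sym (+-suc s n))) end))
             (successors u false)) ⟩
      sum (map (λ l → α n l * length (words m (suc (suc s + n)) stop)) (successors u false))
        ≡⟨ sum-map-* (α n) (length (words m (suc (suc s + n)) stop)) (successors u false) ⟩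
      α (suc n) u * length (words m (suc (suc s + n)) stop)
        ≡⟨ cong (λ t → α (suc n) u * length (words m (suc t) stop)) (+-suc s n) ⟨
      α (suc n) u * length (words m (suc (s + suc n)) stop) ∎
      where open ≡-Reasoning

    mutual
      -- The mark lies either before the `stop`, which gives β, or on it or after it, which gives
      -- `markedFrom stop`.
      length-markedWords-++ : ∀ n s u → StopFree s n → P (s + n) ≡ true →
        length (markedWords (n + suc m) s u) ≡
        β n u * length (words m (suc (s + n)) stop) + α n u * length (markedFrom stop m (suc (s + n)))
      length-markedWords-++ zero    s u free end = trans
        (length-markedWords-suc m s u (trans (cong P (sym (+-identityʳ s))) end))
        (trans (successors-stop u _)
          (cong (λ t → bit (follows u stop) * length (markedFrom stop m (suc t))) (sym (+-identityʳ s))))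
      length-markedWords-++ (suc n) s u free end = begin
        length (markedWords (suc n + suc m) s u)
          ≡⟨ length-markedWords-suc (n + suc m) s u (stopFree-head free) ⟩
        sum (map (λ l → length (markedFrom l (n + suc m) (suc s))) (successors u false))
          ≡⟨ cong sum (map-cong (λ l → length-markedFrom-++ l n (suc s) (stopFree-tail free)
               (trans (cong P (sym (+-suc s n))) end)) (successors u false)) ⟩
        sum (map (λ l → γ n l * w (suc s + n) + α n l * f (suc s + n)) (successors u false))
          ≡⟨ sum-map-+ (λ l → γ n l * w (suc s + n)) (λ l → α n l * f (suc s + n)) (successors u false) ⟩
        sum (map (λ l → γ n l * w (suc s + n)) (successors u false)) +
        sum (map (λ l → α n l * f (suc s + n)) (successors u false))
          ≡⟨ cong₂ _+_ (sum-map-* (γ n) (w (suc s + n)) (successors u false))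
                       (sum-map-* (α n) (f (suc s + n)) (successors u false)) ⟩
        β (suc n) u * w (suc s + n) + α (suc n) u * f (suc s + n)
          ≡⟨ cong (λ t → β (suc n) u * w t + α (suc n) u * f t) (+-suc s n) ⟨
        β (suc n) u * w (s + suc n) + α (suc n) u * f (s + suc n) ∎
        where
        open ≡-Reasoning
        w f : ℕ → ℕ
        w t = length (words m (suc t) stop)
        f t = length (markedFrom stop m (suc t))

      length-markedFrom-++ : ∀ l n s → StopFree s n → P (s + n) ≡ true →
        length (markedFrom l (n + suc m) s) ≡
        γ n l * length (words m (suc (s + n)) stop) + α n l * length (markedFrom stop m (suc (s + n)))
      length-markedFrom-++ l n s free end = begin
        length (markedFrom l (n + suc m) s)
          ≡⟨ length-markedFrom l (n + suc m) s ⟩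
        bit (rimRooted l) * length (words (n + suc m) s l) + length (markedWords (n + suc m) s l)
          ≡⟨ cong₂ (λ x y → bit (rimRooted l) * x + y) (length-words-++ n s l free end) (length-markedWords-++ n s l free end) ⟩
        bit (rimRooted l) * (α n l * W) + (β n l * W + α n l * F)
          ≡⟨ regroup (bit (rimRooted l)) (α n l) (β n l) W F ⟩
        γ n l * W + α n l * F ∎
        where
        open ≡-Reasoning
        W F : ℕ
        W = length (words m (suc (s + n)) stop)
        F = length (markedFrom stop m (suc (s + n)))
        regroup : ∀ i a b w f → i * (a * w) + (b * w + a * f) ≡ (i * a + b) * w + a * f
        regroup = solve-∀

-- Matchings of paths and cycles

module _ {n} {P Q : Pred (Subset n) 0ℓ} (P? : Decidable P) (Q? : Decidable Q) where

  #Subsets-cong : (∀ {M} → P M → Q M) → (∀ {M} → Q M → P M) → #Subsets P? ≡ #Subsets Q?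
  #Subsets-cong P⇒Q Q⇒P = cong length (filter-≐ P? Q? (P⇒Q , Q⇒P) (allSubsets n))

  #Subsets-split : #Subsets P? ≡ #Subsets (λ M → P? M ×-dec Q? M) + #Subsets (λ M → P? M ×-dec ¬? (Q? M))
  #Subsets-split = go (allSubsets n)
    where
    go : ∀ Ms → length (filter P? Ms) ≡
         length (filter (λ M → P? M ×-dec Q? M) Ms) + length (filter (λ M → P? M ×-dec ¬? (Q? M)) Ms)
    go []       = refl
    go (M ∷ Ms) with P? M | Q? M
    ... | no _  | _     = go Ms
    ... | yes _ | yes _ = cong suc (go Ms)
    ... | yes _ | no _  = trans (cong suc (go Ms)) (sym (+-suc _ _))

length-filter-map : {A B : Set} {P : Pred B 0ℓ} (P? : Decidable P) (f : A → B) (xs : List A) →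
                    length (filter P? (map f xs)) ≡ length (filter (P? ∘ f) xs)
length-filter-map P? f []       = refl
length-filter-map P? f (x ∷ xs) with P? (f x)
... | yes _ = cong suc (length-filter-map P? f xs)
... | no _  = length-filter-map P? f xs

#Subsets-suc : ∀ {n} {P : Pred (Subset (suc n)) 0ℓ} (P? : Decidable P) →
               #Subsets P? ≡ #Subsets (P? ∘ (outside ∷_)) + #Subsets (P? ∘ (inside ∷_))
#Subsets-suc {n} P? = trans
  (cong length (filter-++ P? (map (outside ∷_) (allSubsets n)) (map (inside ∷_) (allSubsets n))))
  (trans (length-++ (filter P? (map (outside ∷_) (allSubsets n))))
    (cong₂ _+_ (length-filter-map P? (outside ∷_) (allSubsets n)) (length-filter-map P? (inside ∷_) (allSubsets n))))

#Subsets-head : ∀ {n} {P : Pred (Subset n) 0ℓ} (P? : Decidable P) b →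
                #Subsets (λ M → (b Bool.≟ true) ×-dec P? M) ≡ bit b * #Subsets P?
#Subsets-head {n} P? true = trans (#Subsets-cong (λ M → (true Bool.≟ true) ×-dec P? M) P? proj₂ (refl ,_)) (sym (+-identityʳ _))
#Subsets-head {n} P? false = go (allSubsets n)
  where
  go : ∀ Ms → length (filter (λ M → (false Bool.≟ true) ×-dec P? M) Ms) ≡ 0
  go []       = refl
  go (M ∷ Ms) = go Ms

module _ (rel : Bool → Bool → Bool) where

  chain? : ∀ {n} x y → Decidable (λ (v : Vec Bool n) → Chain rel x v y)
  chain? x y []      = rel x y Bool.≟ true
  chain? x y (a ∷ v) = (rel x a Bool.≟ true) ×-dec chain? a y v

  -- An entry of a power of the transfer matrix of `rel`: the Boolean words of length n between x
  -- and y.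
  #chains : ℕ → Bool → Bool → ℕ
  #chains zero    x y = bit (rel x y)
  #chains (suc n) x y = bit (rel x false) * #chains n false y + bit (rel x true) * #chains n true y

  #Subsets-chain : ∀ n x y → #Subsets {n} (chain? x y) ≡ #chains n x y
  #Subsets-chain zero    x y with rel x y
  ... | true  = refl
  ... | false = refl
  #Subsets-chain (suc n) x y = trans (#Subsets-suc (chain? {suc n} x y)) (cong₂ _+_
    (trans (#Subsets-head (chain? {n} false y) (rel x false)) (cong (bit (rel x false) *_) (#Subsets-chain n false y)))
    (trans (#Subsets-head (chain? {n} true y) (rel x true)) (cong (bit (rel x true) *_) (#Subsets-chain n true y))))

  Cyclic : ∀ {n} → Subset (suc n) → Set
  Cyclic M = ∀ i → rel (lookup M i) (lookup M (next i)) ≡ true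

  cyclic? : ∀ {n} → Decidable (Cyclic {n})
  cyclic? M = Fin.all? (λ i → rel (lookup M i) (lookup M (next i)) Bool.≟ true)

  -- Cutting the cycle at its first edge gives the trace of the transfer matrix power.
  #Subsets-cyclic : ∀ n → #Subsets (cyclic? {n}) ≡ #chains n false false + #chains n true true
  #Subsets-cyclic n = trans (#Subsets-suc (cyclic? {n})) (cong₂ _+_ (starting outside) (starting inside))
    where
    starting : ∀ b → #Subsets (cyclic? {n} ∘ (b ∷_)) ≡ #chains n b b
    starting b = trans
      (#Subsets-cong (cyclic? {n} ∘ (b ∷_)) (chain? {n} b b) (cyclic⇒chain rel b _) (chain⇒cyclic rel b _))
      (#Subsets-chain n b b)

_nand_ : Bool → Bool → Bool
a nand b = not (a ∧ b)

nand⁻ : ∀ {a b} → a nand b ≡ true → ¬ (a ≡ true × b ≡ true)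
nand⁻ () (refl , refl)

nand⁺ : ∀ {a b} → ¬ (a ≡ true × b ≡ true) → a nand b ≡ true
nand⁺ {false} {b}     _ = refl
nand⁺ {true}  {false} _ = refl
nand⁺ {true}  {true}  p = contradiction (refl , refl) p

next≢ : ∀ {n} (i : Fin (suc (suc n))) → next i ≢ i
next≢ {n} i with view i
... | ‵fromℕ     rewrite next-fromℕ (suc n) = λ ()
... | ‵inject₁ j rewrite next-inject₁ j = λ eq → ℕ.1+n≢n (trans (cong toℕ eq) (toℕ-inject₁ j))

module _ {n} (M : Subset (suc (suc n))) where

  -- Edge `next i` begins at the vertex where edge i ends, and the length is at least 2, so the two
  -- edges differ. In the 2-cycle they meet at both vertices and the condition merely occurs twice.
  cycleMatching⇒cyclic : IsMatching (C (suc (suc n))) M → Cyclic _nand_ M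
  cycleMatching⇒cyclic matching i = nand⁺ λ { (p , q) →
    matching i (next i) (lookup⇒[]= i M p) (lookup⇒[]= (next i) M q) (next≢ i ∘ sym)
      (next i , inj₂ refl , inj₁ refl) }

  cyclic⇒cycleMatching : Cyclic _nand_ M → IsMatching (C (suc (suc n))) M
  cyclic⇒cycleMatching cyc i j i∈ j∈ i≢j (v , inj₁ refl , inj₁ p) = i≢j p
  cyclic⇒cycleMatching cyc i j i∈ j∈ i≢j (v , inj₁ refl , inj₂ refl) = nand⁻ (cyc j) ([]=⇒lookup j∈ , []=⇒lookup i∈)
  cyclic⇒cycleMatching cyc i j i∈ j∈ i≢j (v , inj₂ refl , inj₁ refl) = nand⁻ (cyc i) ([]=⇒lookup i∈ , []=⇒lookup j∈)
  cyclic⇒cycleMatching cyc i j i∈ j∈ i≢j (v , inj₂ refl , inj₂ p) =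
    i≢j (trans (sym (prev-next i)) (trans (cong prev p) (prev-next j)))

  -- The edges at vertex `next i` are i and `next i`, and a perfect matching contains exactly one of
  -- them.
  perfectMatching⇒alternating : IsMatching (C (suc (suc n))) M × IsPerfect (C (suc (suc n))) M → Cyclic _xor_ M
  perfectMatching⇒alternating (matching , perfect) i
    with lookup M i in p | lookup M (next i) in q | cycleMatching⇒cyclic matching i | perfect (next i)
  ... | true  | false | _ | _ = refl
  ... | false | true  | _ | _ = refl
  ... | false | false | _ | e , e∈ , inj₁ refl = trans (sym q) ([]=⇒lookup e∈)
  ... | false | false | _ | e , e∈ , inj₂ eq   = trans (sym p)
    (trans (cong (lookup M) (trans (sym (prev-next i)) (trans (cong prev eq) (prev-next e)))) ([]=⇒lookup e∈))

  alternating⇒perfectMatching : Cyclic _xor_ M → IsMatching (C (suc (suc n))) M × IsPerfect (C (suc (suc n))) M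
  alternating⇒perfectMatching alt = cyclic⇒cycleMatching (λ i → xor⇒nand {lookup M i} {lookup M (next i)} (alt i)) , perfect
    where
    xor⇒nand : ∀ {a b} → a xor b ≡ true → a nand b ≡ true
    xor⇒nand {false} {b}     _ = refl
    xor⇒nand {true}  {false} _ = refl
    perfect : IsPerfect (C (suc (suc n))) M
    perfect v with lookup M (prev v) in p | lookup M (next (prev v)) in q | alt (prev v)
    ... | true  | false | _ = prev v , lookup⇒[]= _ M p , inj₂ (sym (next-prev v))
    ... | false | true  | _ = v , lookup⇒[]= v M (trans (cong (lookup M) (sym (next-prev v))) q) , inj₁ refl

module _ {n} (M : Subset n) where

  -- A path is a cycle with one edge deleted: the leading `false` is that absent edge, and it makes
  -- the conditions at both ends of the path automatic.
  pathMatching⇒cyclic : IsMatching (P (suc n)) M → Cyclic _nand_ (false ∷ M)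
  pathMatching⇒cyclic matching i = nand⁺ (go i (view i))
    where
    go : ∀ i → View i → ¬ (lookup (false ∷ M) i ≡ true × lookup (false ∷ M) (next i) ≡ true)
    go i ‵fromℕ         (_ , q) rewrite next-fromℕ n = contradiction q λ ()
    go _ (‵inject₁ zero)    (() , _)
    go _ (‵inject₁ (suc j)) (p , q) rewrite next-inject₁ (suc j) =
      matching (inject₁ j) (suc j) (lookup⇒[]= _ M p) (lookup⇒[]= _ M q) (λ eq → ℕ.1+n≢n (sym (trans (sym (toℕ-inject₁ j)) (cong toℕ eq))))
        (_ , inj₂ refl , inj₁ refl)

  ¬consecutive : Cyclic _nand_ (false ∷ M) → ∀ {i j} → i ∈ M → j ∈ M → inject₁ j ≢ suc i
  ¬consecutive cyc {i} {j} i∈ j∈ eq = nand⁻ (cyc (suc i)) ([]=⇒lookup i∈ ,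
    trans (cong (lookup (false ∷ M)) (trans (cong next (sym eq)) (next-inject₁ j))) ([]=⇒lookup j∈))

  cyclic⇒pathMatching : Cyclic _nand_ (false ∷ M) → IsMatching (P (suc n)) M
  cyclic⇒pathMatching cyc i j i∈ j∈ i≢j (v , inj₁ refl , inj₁ p)  = i≢j (Fin.inject₁-injective p)
  cyclic⇒pathMatching cyc i j i∈ j∈ i≢j (v , inj₂ refl , inj₂ p)  = i≢j (Fin.suc-injective p)
  cyclic⇒pathMatching cyc i j i∈ j∈ i≢j (v , inj₁ refl , inj₂ p) = ¬consecutive cyc j∈ i∈ p
  cyclic⇒pathMatching cyc i j i∈ j∈ i≢j (v , inj₂ refl , inj₁ p) = ¬consecutive cyc i∈ j∈ (sym p)

m-path : ∀ n → m (P (suc n)) ≡ #chains _nand_ n false false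
m-path n = trans
  (#Subsets-cong (isMatching? (P (suc n))) (chain? _nand_ false false)
    (cyclic⇒chain _nand_ false _ ∘ pathMatching⇒cyclic _) (cyclic⇒pathMatching _ ∘ chain⇒cyclic _nand_ false _))
  (#Subsets-chain _nand_ n false false)

#chains-xor : ∀ n x y → #chains _xor_ (suc n) x y ≡ #chains _xor_ n (not x) y
#chains-xor n false y = +-identityʳ _
#chains-xor n true  y = trans (+-identityʳ _) (+-identityʳ _)

-- An alternating word is determined by its first letter, and it closes up because the cycle, of
-- length 2k + 2, is even.
#chains-xor-odd : ∀ k b → #chains _xor_ (suc (k + k)) b b ≡ 1
#chains-xor-odd k b = trans (#chains-xor (k + k) b b) (even k b)
  where
  even : ∀ k b → #chains _xor_ (k + k) (not b) b ≡ 1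
  even zero    false = refl
  even zero    true  = refl
  even (suc k) b rewrite +-suc k k = begin
    #chains _xor_ (suc (suc (k + k))) (not b) b  ≡⟨ #chains-xor (suc (k + k)) (not b) b ⟩
    #chains _xor_ (suc (k + k)) (not (not b)) b  ≡⟨ #chains-xor (k + k) (not (not b)) b ⟩
    #chains _xor_ (k + k) (not (not (not b))) b  ≡⟨ cong (λ c → #chains _xor_ (k + k) (not c) b) (Bool.not-involutive b) ⟩
    #chains _xor_ (k + k) (not b) b              ≡⟨ even k b ⟩
    1                                            ∎
    where open ≡-Reasoning

-- The 2 counts the perfect matchings, one for each choice on the first edge. It is added on the
-- left to avoid a truncated subtraction.
m*-cycle : ∀ k → 2 + m* (C (suc (suc (k + k)))) ≡
           #chains _nand_ (suc (k + k)) false false + #chains _nand_ (suc (k + k)) true true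
m*-cycle k = begin
  2 + m* Cₖ
    ≡⟨ cong (_+ m* Cₖ) (sym perfects) ⟩
  #Subsets (λ M → isMatching? Cₖ M ×-dec isPerfect? Cₖ M) + m* Cₖ
    ≡⟨ #Subsets-split (isMatching? Cₖ) (isPerfect? Cₖ) ⟨
  #Subsets (isMatching? Cₖ)
    ≡⟨ #Subsets-cong (isMatching? Cₖ) (cyclic? _nand_) (cycleMatching⇒cyclic _) (cyclic⇒cycleMatching _) ⟩
  #Subsets (cyclic? _nand_ {suc (k + k)})
    ≡⟨ #Subsets-cyclic _nand_ (suc (k + k)) ⟩
  #chains _nand_ (suc (k + k)) false false + #chains _nand_ (suc (k + k)) true true ∎
  where
  open ≡-Reasoning
  Cₖ : Graph
  Cₖ = C (suc (suc (k + k)))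
  perfects : #Subsets (λ M → isMatching? Cₖ M ×-dec isPerfect? Cₖ M) ≡ 2
  perfects = trans
    (#Subsets-cong (λ M → isMatching? Cₖ M ×-dec isPerfect? Cₖ M) (cyclic? _xor_)
      (perfectMatching⇒alternating _) (alternating⇒perfectMatching _))
    (trans (#Subsets-cyclic _xor_ (suc (k + k))) (cong₂ _+_ (#chains-xor-odd k false) (#chains-xor-odd k true)))

-- Stretch counts as matching numbers

private
  κ : ℕ → Bool → Bool → ℕ
  κ = #chains _nand_

κ-false : ∀ n y → κ (suc n) false y ≡ κ n false y + κ n true y
κ-false n y = cong₂ _+_ (+-identityʳ (κ n false y)) (+-identityʳ (κ n true y))

κ-true : ∀ n y → κ (suc n) true y ≡ κ n false y
κ-true n y = trans (+-identityʳ _) (+-identityʳ _)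

-- After any letter other than a `right`, only its `rimRooted` value restricts what follows. Hence
-- `left true` acts like `stop` and `left false` like `hub`, and four states remain.
α-left-true : ∀ n → α n (left true) ≡ α n stop
α-left-true zero    = refl
α-left-true (suc n) = refl

α-left-false : ∀ n → α n (left false) ≡ α n hub
α-left-false zero    = refl
α-left-false (suc n) = refl

β-left-true : ∀ n → β n (left true) ≡ β n stop
β-left-true zero    = refl
β-left-true (suc n) = refl

β-left-false : ∀ n → β n (left false) ≡ β n hub
β-left-false zero    = refl
β-left-false (suc n) = refl

-- Up to the closing `stop`, only `right true` may follow `right true`. This leaves a single word,
-- each of whose n letters may carry the mark.
α-right-true : ∀ n → α n (right true) ≡ 1
α-right-true zero    = refl
α-right-true (suc n) = trans (+-identityʳ _) (α-right-true n)

β-right-true : ∀ n → β n (right true) ≡ n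
β-right-true zero    = refl
β-right-true (suc n) = trans (+-identityʳ _)
  (cong₂ (λ x y → x + 0 + y) (α-right-true n) (β-right-true n))

-- The successors of `hub` and `stop` differ only in the flag of `left`, which by induction does not
-- change the unmarked count.
α-hub : ∀ n → α n hub ≡ α n stop
α-hub zero    = refl
α-hub (suc n) = cong (_+ (α n (right true) + (α n (right false) + (α n hub + 0)))) (trans (α-left-false n) (trans (α-hub n) (sym (α-left-true n))))

-- κ (n + n) satisfies the same two-term recursion as α n.
α-κ : ∀ n → α n stop ≡ κ (n + n) false false × 1 + α n (right false) ≡ κ (n + n) true false
α-κ zero = refl , refl
α-κ (suc n) rewrite +-suc n n | κ-false (suc (n + n)) false | κ-true (suc (n + n)) false
  | κ-false (n + n) false | κ-true (n + n) false | α-left-true n | α-right-true n | α-hub n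
  with α-κ n
... | p , q rewrite sym p | sym q = eq₁ (α n stop) (α n (right false)) , eq₂ (α n stop) (α n (right false))
  where
  eq₁ : ∀ a u → a + (1 + (u + (a + 0))) ≡ a + (1 + u) + a
  eq₁ = solve-∀
  eq₂ : ∀ a u → 1 + (u + (a + 0)) ≡ a + (1 + u)
  eq₂ = solve-∀

-- The recursion of β has an inhomogeneous term 1 + n, contributed by `right true`. The summands 1
-- and n absorb it and leave the recursion of κ.
β-κ : ∀ n → 1 + β n hub ≡ κ (n + n) false true × β n (right false) + n ≡ κ (n + n) true true
β-κ zero = refl , refl
β-κ (suc n) rewrite +-suc n n | κ-false (suc (n + n)) true | κ-true (suc (n + n)) true
  | κ-false (n + n) true | κ-true (n + n) true | α-right-true n | β-right-true n | β-left-false n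
  with β-κ n
... | p , q rewrite sym p | sym q = eq₁ (β n hub) (β n (right false)) n , eq₂ (β n hub) (β n (right false)) n
  where
  eq₁ : ∀ c e n → 1 + (c + (1 + n + (e + (c + 0)))) ≡ 1 + c + (e + n) + (1 + c)
  eq₁ = solve-∀
  eq₂ : ∀ c e n → e + (c + 0) + suc n ≡ 1 + c + (e + n)
  eq₂ = solve-∀

-- Both sides have the same increment from n to n + 1, namely the sum of `α n stop`, 1 + n,
-- `β n (right false)` and `β n hub`.
β-stop : ∀ n → 2 + β n stop ≡ κ (n + n) true false + κ (n + n) false true
β-stop zero = refl
β-stop (suc n) with α-κ (suc n) | β-κ (suc n) | α-κ n | β-κ n | β-stop n
... | _ , q | p , _ | _ , q′ | p′ , _ | ih
  rewrite sym q | sym p | sym q′ | sym p′ | α-left-true n | α-right-true n | β-right-true n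
    | β-left-true n | β-left-false n | α-hub n
  = trans (eq (α n stop) (β n stop) n (β n (right false)) (β n hub))
    (trans (cong (α n stop + 1 + n + β n (right false) + β n hub +_) ih)
      (eq′ (α n stop) (α n (right false)) n (β n (right false)) (β n hub)))
  where
  eq : ∀ a b n e c → 2 + (a + 0 + b + (1 + n + (e + (c + 0)))) ≡ (a + 1 + n + e + c) + (2 + b)
  eq = solve-∀
  eq′ : ∀ a u n e c → (a + 1 + n + e + c) + (1 + u + (1 + c)) ≡ 1 + (u + (a + 0)) + (1 + (c + (1 + n + (e + (c + 0)))))
  eq′ = solve-∀

α-path : ∀ n → α n stop ≡ m (P (suc (n + n)))
α-path n = trans (proj₁ (α-κ n)) (sym (m-path (n + n)))

-- The mark is on the opening root, giving α, or inside the stretch, giving β. The 2 of `β-stop` is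
-- the 2 of `m*-cycle`, that is, the two perfect matchings.
γ-cycle : ∀ n → γ n stop ≡ m* (C (suc (suc (n + n))))
γ-cycle n = ℕ.+-cancelˡ-≡ 2 _ _ (begin
  2 + (α n stop + 0 + β n stop)
    ≡⟨ eq (α n stop) (β n stop) ⟩
  α n stop + (2 + β n stop)
    ≡⟨ cong₂ _+_ (proj₁ (α-κ n)) (β-stop n) ⟩
  κ (n + n) false false + (κ (n + n) true false + κ (n + n) false true)
    ≡⟨ ℕ.+-assoc (κ (n + n) false false) _ _ ⟨
  κ (n + n) false false + κ (n + n) true false + κ (n + n) false true
    ≡⟨ cong₂ _+_ (κ-false (n + n) false) (κ-true (n + n) true) ⟨
  κ (suc (n + n)) false false + κ (suc (n + n)) true true
    ≡⟨ m*-cycle n ⟨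
  2 + m* (C (suc (suc (n + n)))) ∎)
  where
  open ≡-Reasoning
  eq : ∀ a b → 2 + (a + 0 + b) ≡ a + (2 + b)
  eq = solve-∀

-- Counting forests of the wheel

unique-⊆⇒length≤ : {A : Set} {xs ys : List A} → Unique xs → (∀ {x} → x List.∈ xs → x List.∈ ys) →
                   length xs ≤ length ys
unique-⊆⇒length≤ [] _ = z≤n
unique-⊆⇒length≤ {xs = x ∷ xs} (x∉xs ∷ u) xs⊆ys with ∈-∃++ (xs⊆ys (here refl))
... | as , bs , refl = begin
  suc (length xs)               ≤⟨ s≤s (unique-⊆⇒length≤ u (λ y∈ → remove (All.lookup x∉xs y∈) (xs⊆ys (there y∈)))) ⟩
  suc (length (as ++ bs))       ≡⟨ cong suc (length-++ as) ⟩
  suc (length as + length bs)   ≡⟨ +-suc (length as) (length bs) ⟨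
  length as + suc (length bs)   ≡⟨ length-++ as ⟨
  length (as ++ x ∷ bs)         ∎
  where
  open ℕ.≤-Reasoning
  remove : ∀ {y} → x ≢ y → y List.∈ as ++ x ∷ bs → y List.∈ as ++ bs
  remove x≢y y∈ with ∈-++⁻ as y∈
  ... | inj₁ y∈as         = ∈-++⁺ˡ y∈as
  ... | inj₂ (here eq)    = contradiction (sym eq) x≢y
  ... | inj₂ (there y∈bs) = ∈-++⁺ʳ as y∈bs

unique-map : {A B : Set} (f : A → B) {xs : List A} →
             (∀ {x y} → x List.∈ xs → y List.∈ xs → f x ≡ f y → x ≡ y) → Unique xs → Unique (map f xs)
unique-map f inj []         = []
unique-map f {x ∷ xs} inj (x∉xs ∷ u) =
  All.map⁺ (All.tabulate (λ y∈ eq → All.lookup x∉xs y∈ (inj (here refl) (there y∈) eq)))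
  ∷ unique-map f (λ x∈ y∈ → inj (there x∈) (there y∈)) u

∈-allSubsets : ∀ {n} (M : Subset n) → M List.∈ allSubsets n
∈-allSubsets []            = here refl
∈-allSubsets (outside ∷ M) = ∈-++⁺ˡ (∈-map⁺ (outside ∷_) (∈-allSubsets M))
∈-allSubsets (inside ∷ M)  = ∈-++⁺ʳ (map (outside ∷_) (allSubsets _)) (∈-map⁺ (inside ∷_) (∈-allSubsets M))

unique-allSubsets : ∀ n → Unique (allSubsets n)
unique-allSubsets zero    = [] ∷ []
unique-allSubsets (suc n) = Unique.++⁺ (Unique.map⁺ ∷-injectiveʳ (unique-allSubsets n))
  (Unique.map⁺ ∷-injectiveʳ (unique-allSubsets n)) λ { (M∈ , M∈′) → disjoint (∈-map⁻ _ M∈) (∈-map⁻ _ M∈′) }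
  where
  disjoint : ∀ {M : Subset (suc n)} → ∃[ A ] (A List.∈ allSubsets n × M ≡ outside ∷ A) →
             ¬ (∃[ B ] (B List.∈ allSubsets n × M ≡ inside ∷ B))
  disjoint (_ , _ , refl) (_ , _ , ())

-- The filtered subsets and the images of xs are duplicate-free lists with the same members, so each
-- is at most as long as the other.
#Subsets≡length : ∀ {n} {P : Pred (Subset n) 0ℓ} (P? : Decidable P) {A : Set} (f : A → Subset n) {xs : List A} →
                  Unique xs → (∀ {x y} → x List.∈ xs → y List.∈ xs → f x ≡ f y → x ≡ y) →
                  (∀ {x} → x List.∈ xs → P (f x)) → (∀ {M} → P M → M List.∈ map f xs) →
                  #Subsets P? ≡ length xs
#Subsets≡length {n} {P} P? f {xs} unique injective sound complete = trans
  (ℕ.≤-antisym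
    (unique-⊆⇒length≤ (Unique.filter⁺ P? (unique-allSubsets n)) (complete ∘ proj₂ ∘ ∈-filter⁻ P? {xs = allSubsets n}))
    (unique-⊆⇒length≤ (unique-map f injective unique) sound′))
  (length-map f xs)
  where
  sound′ : ∀ {M} → M List.∈ map f xs → M List.∈ filter P? (allSubsets n)
  sound′ M∈ with ∈-map⁻ f M∈
  ... | x , x∈ , refl = ∈-filter⁺ P? (∈-allSubsets (f x)) (sound x∈)

-- Sums, products and intervals by recursion on the number of roots

map-allFin-suc : ∀ {A : Set} {r} (f : Fin (suc r) → A) → map f (allFin (suc r)) ≡ f zero ∷ map (f ∘ suc) (allFin r)
map-allFin-suc f = cong (f zero ∷_) (trans (map-tabulate suc f) (sym (map-tabulate id (f ∘ suc))))

∑-suc : ∀ {r} (f : Fin (suc r) → ℕ) → ∑ f ≡ f zero + ∑ (f ∘ suc)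
∑-suc f = cong sum (map-allFin-suc f)

∑-cong : ∀ {r} {f g : Fin r → ℕ} → (∀ i → f i ≡ g i) → ∑ f ≡ ∑ g
∑-cong {r} eq = cong sum (map-cong eq (allFin r))

∏ : ∀ {r} → (Fin r → ℕ) → ℕ
∏ {r} f = product (map f (allFin r))

∏-suc : ∀ {r} (f : Fin (suc r) → ℕ) → ∏ f ≡ f zero * ∏ (f ∘ suc)
∏-suc f = cong product (map-allFin-suc f)

∏-except-cong : ∀ {r} (i : Fin r) {f g : Fin r → ℕ} → (∀ j → f j ≡ g j) → ∏-except i f ≡ ∏-except i g
∏-except-cong {r} i eq = cong product (map-cong eq (filter (λ j → ¬? (j ≟ i)) (allFin r)))

tabulate-suc : ∀ r → List.tabulate {A = Fin (suc r)} {n = r} Fin.suc ≡ map Fin.suc (allFin r)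
tabulate-suc r = sym (map-tabulate {A = Fin r} {B = Fin (suc r)} id Fin.suc)

∏-except-zero : ∀ {r} (f : Fin (suc r) → ℕ) → ∏-except zero f ≡ ∏ (f ∘ suc)
∏-except-zero {r} f = cong product (trans
  (cong (map f ∘ filter (λ j → ¬? (j ≟ zero))) (tabulate-suc r)) (go (allFin r)))
  where
  go : ∀ js → map f (filter (λ j → ¬? (j ≟ zero)) (map suc js)) ≡ map (f ∘ suc) js
  go []       = refl
  go (j ∷ js) = cong (f (suc j) ∷_) (go js)

∏-except-suc : ∀ {r} (i : Fin r) (f : Fin (suc r) → ℕ) → ∏-except (suc i) f ≡ f zero * ∏-except i (f ∘ suc)
∏-except-suc {r} i f = cong (λ ks → f zero * product ks) (trans
  (cong (map f ∘ filter (λ j → ¬? (j ≟ suc i))) (tabulate-suc r)) (go (allFin r)))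
  where
  go : ∀ js → map f (filter (λ j → ¬? (j ≟ suc i)) (map suc js)) ≡ map (f ∘ suc) (filter (λ j → ¬? (j ≟ i)) js)
  go []       = refl
  go (j ∷ js) with j ≟ i
  ... | yes _ = go js
  ... | no _  = cong (f (suc j) ∷_) (go js)

-- The product rule: the distinguished factor is the first one or a later one. It has the shape of
-- `length-markedFrom-++`.
∑-∏-except-suc : ∀ {r} (f g : Fin (suc r) → ℕ) → ∑ (λ i → f i * ∏-except i g) ≡
                 f zero * ∏ (g ∘ suc) + g zero * ∑ (λ i → f (suc i) * ∏-except i (g ∘ suc))
∑-∏-except-suc {r} f g = trans (∑-suc (λ i → f i * ∏-except i g)) (cong₂ _+_
  (cong (f zero *_) (∏-except-zero g))
  (trans (∑-cong {r} (λ i → trans (cong (f (suc i) *_) (∏-except-suc i g)) (swap (f (suc i)) (g zero) _)))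
    (∑-* (λ i → f (suc i) * ∏-except i (g ∘ suc)))))
  where
  swap : ∀ a b c → a * (b * c) ≡ b * (a * c)
  swap = solve-∀
  ∑-* : ∀ {r} (h : Fin r → ℕ) → ∑ (λ i → g zero * h i) ≡ g zero * ∑ h
  ∑-* {zero}  h = sym (ℕ.*-zeroʳ (g zero))
  ∑-* {suc r} h = trans (∑-suc (λ i → g zero * h i))
    (trans (cong (g zero * h zero +_) (∑-* (h ∘ suc)))
      (trans (sym (ℕ.*-distribˡ-+ (g zero) (h zero) _)) (cong (g zero *_) (sym (∑-suc h)))))

-- The cyclic intervals with the end point E as a parameter. Dropping the first root keeps E, which
-- makes induction on the roots possible, whereas `cyclicInterval` refers back to the first root.
gap : ∀ {r} → (Fin (suc r) → ℕ) → ℕ → Fin (suc r) → ℕ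
gap {zero}  b E zero    = E ∸ b zero
gap {suc r} b E zero    = b (suc zero) ∸ b zero
gap {suc r} b E (suc i) = gap (b ∘ suc) E i

gap-fromℕ : ∀ r (b : Fin (suc r) → ℕ) E → gap b E (fromℕ r) ≡ E ∸ b (fromℕ r)
gap-fromℕ zero    b E = refl
gap-fromℕ (suc r) b E = gap-fromℕ r (b ∘ suc) E

gap-inject₁ : ∀ {r} (b : Fin (suc r) → ℕ) E j → gap b E (inject₁ j) ≡ b (suc j) ∸ b (inject₁ j)
gap-inject₁ {suc r} b E zero    = refl
gap-inject₁ {suc r} b E (suc j) = gap-inject₁ (b ∘ suc) E j

cyclicInterval≡gap : ∀ {N r} (a : Fin (suc r) → Fin N) i →
                     cyclicInterval a i ≡ gap (toℕ ∘ a) (toℕ (a zero) + N) i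
cyclicInterval≡gap {N} {r} a i with view i
... | ‵fromℕ     = sym (gap-fromℕ r (toℕ ∘ a) (toℕ (a zero) + N))
... | ‵inject₁ j = sym (gap-inject₁ (toℕ ∘ a) (toℕ (a zero) + N) j)

Increasing : ∀ {r} → (Fin r → ℕ) → Set
Increasing b = ∀ i j → i Fin.< j → b i < b j

gap>0 : ∀ {r} (b : Fin (suc r) → ℕ) E → Increasing b → (∀ i → b i < E) → ∀ i → 0 < gap b E i
gap>0 {zero}  b E inc b<E zero    = ℕ.m<n⇒0<n∸m (b<E zero)
gap>0 {suc r} b E inc b<E zero    = ℕ.m<n⇒0<n∸m (inc zero (suc zero) (s≤s z≤n))
gap>0 {suc r} b E inc b<E (suc i) = gap>0 (b ∘ suc) E (λ i j → inc (suc i) (suc j) ∘ s≤s) (b<E ∘ suc) i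

module _ (P : ℕ → Bool) where
  open Words P
  open Segments P

  -- Induction on the number of roots, splitting off the stretch that opens at `b zero`. The
  -- hypotheses on P say that between `b zero` and E its true values are exactly the b i, and E is
  -- the position of the closing `stop`.
  lengths-by-gaps : ∀ {r} (b : Fin (suc r) → ℕ) E n → E ≡ suc (b zero + n) → Increasing b → (∀ i → b i < E) →
    (∀ i → P (b i) ≡ true) → (∀ s → b zero ≤ s → s < E → P s ≡ true → ∃[ i ] s ≡ b i) →
    length (words n (suc (b zero)) stop) ≡ ∏ (λ i → α (gap b E i ∸ 1) stop) ×
    length (markedFrom stop n (suc (b zero))) ≡
      ∑ (λ i → γ (gap b E i ∸ 1) stop * ∏-except i (λ j → α (gap b E j ∸ 1) stop))
  lengths-by-gaps {zero} b E n refl inc b<E at only =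
    trans (length-words-last n (suc (b zero)) stop free) (trans (cong (λ k → α k stop) n≡) (sym (ℕ.*-identityʳ _))) ,
    trans (length-markedFrom-last stop n (suc (b zero)) free) (trans (cong (λ k → γ k stop) n≡)
      (trans (sym (ℕ.*-identityʳ _)) (sym (+-identityʳ _))))
    where
    n≡ : n ≡ suc (b zero + n) ∸ b zero ∸ 1
    n≡ = sym (trans (cong (λ x → x ∸ b zero ∸ 1) (sym (+-suc (b zero) n))) (cong (_∸ 1) (ℕ.m+n∸m≡n (b zero) (suc n))))
    free : StopFree (suc (b zero)) n
    free k k<n with P (suc (b zero) + k) in eq
    ... | false = refl
    ... | true with only (suc (b zero) + k) (≤-trans (ℕ.n≤1+n _) (ℕ.m≤m+n (suc (b zero)) k)) (s≤s (ℕ.+-monoʳ-< (b zero) k<n)) eq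
    ...   | zero , eq′ = contradiction (sym eq′) (ℕ.<⇒≢ (s≤s (ℕ.m≤m+n (b zero) k)))
  lengths-by-gaps {suc r} b E n E≡ inc b<E at only
    with ℕ.m≤n⇒∃[o]m+o≡n (inc zero (suc zero) (s≤s z≤n)) | ℕ.m≤n⇒∃[o]m+o≡n (b<E (suc zero))
  -- There are n₀ positions between the first two roots and m between the second root and E; the
  -- extra 1 in `n₀ + suc m` is the second root.
  ... | n₀ , b₁≡ | m , E≡′ = subst
      (λ n → length (words n (suc (b zero)) stop) ≡ ∏ (λ i → α (gap b E i ∸ 1) stop) ×
        length (markedFrom stop n (suc (b zero))) ≡
          ∑ (λ i → γ (gap b E i ∸ 1) stop * ∏-except i (λ j → α (gap b E j ∸ 1) stop)))
      (sym n≡) (byWords , byMarked)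
    where
    open ≡-Reasoning
    n≡ : n ≡ n₀ + suc m
    n≡ = ℕ.+-cancelˡ-≡ (suc (b zero)) n (n₀ + suc m) (begin
      suc (b zero + n)             ≡⟨ E≡ ⟨
      E                            ≡⟨ E≡′ ⟨
      suc (b (suc zero) + m)       ≡⟨ cong (λ x → suc (x + m)) b₁≡ ⟨
      suc (suc (b zero) + n₀ + m)  ≡⟨ shift (b zero) n₀ m ⟩
      suc (b zero) + (n₀ + suc m)  ∎)
      where
      shift : ∀ x y z → suc (suc x + y + z) ≡ suc x + (y + suc z)
      shift = solve-∀
    n₀≡ : n₀ ≡ b (suc zero) ∸ b zero ∸ 1
    n₀≡ = sym (trans (cong (λ x → x ∸ b zero ∸ 1) (trans (sym b₁≡) (sym (+-suc (b zero) n₀))))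
      (cong (_∸ 1) (ℕ.m+n∸m≡n (b zero) (suc n₀))))
    ih = lengths-by-gaps (b ∘ suc) E m (sym E≡′) (λ i j → inc (suc i) (suc j) ∘ s≤s) (b<E ∘ suc) (at ∘ suc) only′
      where
      only′ : ∀ s → b (suc zero) ≤ s → s < E → P s ≡ true → ∃[ i ] s ≡ b (suc i)
      only′ s b₁≤s s<E p with only s (≤-trans (<⇒≤ (inc zero (suc zero) (s≤s z≤n))) b₁≤s) s<E p
      ... | zero  , refl = contradiction (inc zero (suc zero) (s≤s z≤n)) (ℕ.≤⇒≯ b₁≤s)
      ... | suc i , eq   = i , eq
    free : StopFree (suc (b zero)) n₀
    free k k<n₀ with P (suc (b zero) + k) in eq
    ... | false = refl
    ... | true with only (suc (b zero) + k) (≤-trans (ℕ.n≤1+n _) (ℕ.m≤m+n (suc (b zero)) k))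
                         (ℕ.<-trans s<b₁ (b<E (suc zero))) eq
      where
      s<b₁ : suc (b zero) + k < b (suc zero)
      s<b₁ = subst (suc (b zero) + k <_) b₁≡ (ℕ.+-monoʳ-< (suc (b zero)) k<n₀)
    ...   | zero , eq′  = contradiction (sym eq′) (ℕ.<⇒≢ (s≤s (ℕ.m≤m+n (b zero) k)))
    ...   | suc i , eq′ = contradiction (subst (_≤ suc (b zero) + k) (sym b₁≡) (subst (b (suc zero) ≤_) (sym eq′) (b₁≤ i)))
                            (ℕ.<⇒≱ (ℕ.+-monoʳ-< (suc (b zero)) k<n₀))
      where
      b₁≤ : ∀ i → b (suc zero) ≤ b (suc i)
      b₁≤ zero    = ≤-refl
      b₁≤ (suc i) = <⇒≤ (inc (suc zero) (suc (suc i)) (s≤s (s≤s z≤n)))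
    end : P (suc (b zero) + n₀) ≡ true
    end = trans (cong P b₁≡) (at (suc zero))
    byWords : length (words (n₀ + suc m) (suc (b zero)) stop) ≡ ∏ (λ i → α (gap b E i ∸ 1) stop)
    byWords = begin
      length (words (n₀ + suc m) (suc (b zero)) stop)
        ≡⟨ length-words-++ m n₀ (suc (b zero)) stop free end ⟩
      α n₀ stop * length (words m (suc (suc (b zero) + n₀)) stop)
        ≡⟨ cong₂ (λ k t → α k stop * length (words m (suc t) stop)) n₀≡ b₁≡ ⟩
      α (b (suc zero) ∸ b zero ∸ 1) stop * length (words m (suc (b (suc zero))) stop)
        ≡⟨ cong (α (b (suc zero) ∸ b zero ∸ 1) stop *_) (proj₁ ih) ⟩
      α (b (suc zero) ∸ b zero ∸ 1) stop * ∏ (λ i → α (gap (b ∘ suc) E i ∸ 1) stop)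
        ≡⟨ ∏-suc (λ i → α (gap b E i ∸ 1) stop) ⟨
      ∏ (λ i → α (gap b E i ∸ 1) stop) ∎
    byMarked : length (markedFrom stop (n₀ + suc m) (suc (b zero))) ≡
               ∑ (λ i → γ (gap b E i ∸ 1) stop * ∏-except i (λ j → α (gap b E j ∸ 1) stop))
    byMarked = begin
      length (markedFrom stop (n₀ + suc m) (suc (b zero)))
        ≡⟨ length-markedFrom-++ m stop n₀ (suc (b zero)) free end ⟩
      γ n₀ stop * length (words m (suc (suc (b zero) + n₀)) stop) +
      α n₀ stop * length (markedFrom stop m (suc (suc (b zero) + n₀)))
        ≡⟨ cong₂ (λ k t → γ k stop * length (words m (suc t) stop) + α k stop * length (markedFrom stop m (suc t))) n₀≡ b₁≡ ⟩
      γ g₀ stop * length (words m (suc (b (suc zero))) stop) +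
      α g₀ stop * length (markedFrom stop m (suc (b (suc zero))))
        ≡⟨ cong₂ (λ x y → γ g₀ stop * x + α g₀ stop * y) (proj₁ ih) (proj₂ ih) ⟩
      γ g₀ stop * ∏ (λ i → α (gap (b ∘ suc) E i ∸ 1) stop) +
      α g₀ stop * ∑ (λ i → γ (gap (b ∘ suc) E i ∸ 1) stop * ∏-except i (λ j → α (gap (b ∘ suc) E j ∸ 1) stop))
        ≡⟨ ∑-∏-except-suc (λ i → γ (gap b E i ∸ 1) stop) (λ i → α (gap b E i ∸ 1) stop) ⟨
      ∑ (λ i → γ (gap b E i ∸ 1) stop * ∏-except i (λ j → α (gap b E j ∸ 1) stop)) ∎
      where
      g₀ : ℕ
      g₀ = b (suc zero) ∸ b zero ∸ 1

lookup-injective : ∀ {A : Set} {n} {v w : Vec A n} → (∀ i → lookup v i ≡ lookup w i) → v ≡ w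
lookup-injective {v = v} {w} eq = trans (sym (tabulate∘lookup v)) (trans (tabulate-cong eq) (tabulate∘lookup w))

-- Rim vertices are numbered from the root i₀ on.
module Rotation {n : ℕ} (i₀ : Fin (suc n)) where

  -- Words number their positions linearly from i₀ upwards, past the end of the rim; only here are
  -- they reduced modulo its length.
  position : ℕ → Fin (suc n)
  position s = s mod suc n

  vertex : Fin (suc n) → Fin (suc n)
  vertex k = position (toℕ i₀ + toℕ k)

  index : Fin (suc n) → Fin (suc n)
  index v = (toℕ v + (suc n ∸ toℕ i₀)) mod suc n

  toℕ-vertex : ∀ k → toℕ (vertex k) ≡ (toℕ i₀ + toℕ k) % suc n
  toℕ-vertex k = toℕ-mod (toℕ i₀ + toℕ k) (suc n)

  position-toℕ : ∀ v → position (toℕ v) ≡ v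
  position-toℕ v = toℕ-injective (trans (toℕ-mod (toℕ v) (suc n)) (m<n⇒m%n≡m (toℕ<n v)))

  private
    cycle : ∀ v → (toℕ v + suc n) % suc n ≡ toℕ v
    cycle v = trans ([m+n]%n≡m%n (toℕ v) (suc n)) (m<n⇒m%n≡m (toℕ<n v))

    i₀+ : toℕ i₀ + (suc n ∸ toℕ i₀) ≡ suc n
    i₀+ = ℕ.m+[n∸m]≡n (<⇒≤ (toℕ<n i₀))

  open ≡-Reasoning

  vertex-index : ∀ v → vertex (index v) ≡ v
  vertex-index v = toℕ-injective (begin
    toℕ (vertex (index v))
      ≡⟨ toℕ-vertex (index v) ⟩
    (toℕ i₀ + toℕ (index v)) % suc n
      ≡⟨ cong (_% suc n) (ℕ.+-comm (toℕ i₀) _) ⟩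
    (toℕ (index v) + toℕ i₀) % suc n
      ≡⟨ cong (λ x → (x + toℕ i₀) % suc n) (toℕ-mod (toℕ v + (suc n ∸ toℕ i₀)) (suc n)) ⟩
    ((toℕ v + (suc n ∸ toℕ i₀)) % suc n + toℕ i₀) % suc n
      ≡⟨ [m%n+o]%n≡[m+o]%n (toℕ v + (suc n ∸ toℕ i₀)) (toℕ i₀) (suc n) ⟩
    (toℕ v + (suc n ∸ toℕ i₀) + toℕ i₀) % suc n
      ≡⟨ cong (_% suc n) (trans (ℕ.+-assoc (toℕ v) _ _) (cong (toℕ v +_) (trans (ℕ.+-comm _ (toℕ i₀)) i₀+))) ⟩
    (toℕ v + suc n) % suc n
      ≡⟨ cycle v ⟩
    toℕ v ∎)

  index-vertex : ∀ k → index (vertex k) ≡ k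
  index-vertex k = toℕ-injective (begin
    toℕ (index (vertex k))
      ≡⟨ toℕ-mod (toℕ (vertex k) + (suc n ∸ toℕ i₀)) (suc n) ⟩
    (toℕ (vertex k) + (suc n ∸ toℕ i₀)) % suc n
      ≡⟨ cong (λ x → (x + (suc n ∸ toℕ i₀)) % suc n) (toℕ-vertex k) ⟩
    ((toℕ i₀ + toℕ k) % suc n + (suc n ∸ toℕ i₀)) % suc n
      ≡⟨ [m%n+o]%n≡[m+o]%n (toℕ i₀ + toℕ k) (suc n ∸ toℕ i₀) (suc n) ⟩
    (toℕ i₀ + toℕ k + (suc n ∸ toℕ i₀)) % suc n
      ≡⟨ cong (_% suc n) (trans (cong (_+ (suc n ∸ toℕ i₀)) (ℕ.+-comm (toℕ i₀) (toℕ k)))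
           (trans (ℕ.+-assoc (toℕ k) (toℕ i₀) _) (cong (toℕ k +_) i₀+))) ⟩
    (toℕ k + suc n) % suc n
      ≡⟨ cycle k ⟩
    toℕ k ∎)

  vertex-next : ∀ k → vertex (next k) ≡ next (vertex k)
  vertex-next k = toℕ-injective (begin
    toℕ (vertex (next k))
      ≡⟨ toℕ-vertex (next k) ⟩
    (toℕ i₀ + toℕ (next k)) % suc n
      ≡⟨ cong (_% suc n) (trans (cong (toℕ i₀ +_) (toℕ-next k)) (ℕ.+-comm (toℕ i₀) _)) ⟩
    (suc (toℕ k) % suc n + toℕ i₀) % suc n
      ≡⟨ [m%n+o]%n≡[m+o]%n (suc (toℕ k)) (toℕ i₀) (suc n) ⟩
    (suc (toℕ k) + toℕ i₀) % suc n
      ≡⟨ cong (_% suc n) (trans (cong suc (ℕ.+-comm (toℕ k) (toℕ i₀))) (ℕ.+-comm 1 _)) ⟩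
    (toℕ i₀ + toℕ k + 1) % suc n
      ≡⟨ [m%n+o]%n≡[m+o]%n (toℕ i₀ + toℕ k) 1 (suc n) ⟨
    ((toℕ i₀ + toℕ k) % suc n + 1) % suc n
      ≡⟨ cong (λ x → (x + 1) % suc n) (toℕ-vertex k) ⟨
    (toℕ (vertex k) + 1) % suc n
      ≡⟨ cong (_% suc n) (ℕ.+-comm _ 1) ⟩
    suc (toℕ (vertex k)) % suc n
      ≡⟨ toℕ-next (vertex k) ⟨
    toℕ (next (vertex k)) ∎)

  index-next : ∀ v → index (next v) ≡ next (index v)
  index-next v = begin
    index (next v)                   ≡⟨ cong (index ∘ next) (vertex-index v) ⟨
    index (next (vertex (index v)))  ≡⟨ cong index (vertex-next (index v)) ⟨
    index (vertex (next (index v)))  ≡⟨ index-vertex (next (index v)) ⟩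
    next (index v)                   ∎

module ForestCount {n : ℕ} (R : Subset (suc (suc n))) (centre∉R : zero ∉ R)
                   (i₀ : Fin (suc n)) (i₀∈R : rim i₀ ∈ R) where
  open Rotation i₀
  open Wheel R centre∉R

  stopAt : ℕ → Bool
  stopAt s = does (rim (position s) ∈? R)

  open Words stopAt

  -- The cyclic word is cut at the root i₀: its letter is the opening `stop`, and the same root one
  -- turn later is the closing one, leaving n letters to choose.
  codes : List (Marked (suc n))
  codes = markedFrom stop n (suc (toℕ i₀))

  forestOf : Marked (suc n) → Subset (suc n + suc n)
  forestOf (w , k) = parentEdges (lookup w ∘ index) (vertex k)

  code-fits : ∀ {v : Vec Letter n} → Fits (suc (toℕ i₀)) v →
              ∀ j → isStop (lookup (stop ∷ v) j) ≡ stopAt (toℕ i₀ + toℕ j)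
  code-fits fits zero = sym (trans (cong stopAt (+-identityʳ (toℕ i₀)))
    (dec-true (rim (position (toℕ i₀)) ∈? R) (subst (λ i → rim i ∈ R) (sym (position-toℕ i₀)) i₀∈R)))
  code-fits fits (suc k) = trans (fits k) (cong stopAt (sym (+-suc (toℕ i₀) (toℕ k))))

  isStop⇒≡ : ∀ {l} → isStop l ≡ true → l ≡ stop
  isStop⇒≡ {stop} _ = refl

  code-valid : ∀ {w k} → (w , k) List.∈ codes → Valid (lookup w ∘ index) (vertex k)
  code-valid {w} {k} wk∈ with ∈-markedFrom⁻ (suc (toℕ i₀)) stop w k wk∈
  ... | v , refl , v∈ , q with ∈-words⁻ (suc (toℕ i₀)) stop v v∈
  ...   | chain , fits = record
    { stop⇒root = λ {i} eq → does-true⁻ (rim i ∈? R) (trans (sym (isStop≡ i)) (cong isStop eq))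
    ; root⇒stop = λ {i} i∈R → isStop⇒≡ (trans (isStop≡ i) (dec-true (rim i ∈? R) i∈R))
    ; following = λ i → subst (λ j → follows (lookup (stop ∷ v) (index i)) (lookup (stop ∷ v) j) ≡ true)
        (sym (index-next i)) (chain⇒cyclic follows stop v chain (index i))
    ; hubward   = trans (cong (rimRooted ∘ lookup (stop ∷ v)) (index-vertex k)) q
    }
    where
    isStop≡ : ∀ i → isStop (lookup (stop ∷ v) (index i)) ≡ does (rim i ∈? R)
    isStop≡ i = trans (code-fits fits (index i)) (cong (λ j → does (rim j ∈? R)) (vertex-index i))

  forestOf-injective : ∀ {x y} → x List.∈ codes → y List.∈ codes → forestOf x ≡ forestOf y → x ≡ y
  forestOf-injective {w , k} {w′ , k′} x∈ y∈ eq = cong₂ _,_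
    (lookup-injective λ j → begin
      lookup w j                    ≡⟨ cong (lookup w) (index-vertex j) ⟨
      lookup w (index (vertex j))   ≡⟨ ℓ-injective (code-valid x∈) (code-valid y∈) i₀∈R eq (vertex j) ⟩
      lookup w′ (index (vertex j))  ≡⟨ cong (lookup w′) (index-vertex j) ⟩
      lookup w′ j                   ∎)
    (trans (sym (index-vertex k)) (trans (cong index (z-injective (code-valid x∈) (code-valid y∈) i₀∈R eq)) (index-vertex k′)))
    where open ≡-Reasoning

  forestOf-forest : ∀ {x} → x List.∈ codes → IsRootedSpanningForest (wheel (suc n)) R (forestOf x)
  forestOf-forest x∈ = IsParentMap.forest (valid⇒parentMap (code-valid x∈) i₀∈R)

  parentEdges-cong : ∀ {ℓ ℓ′ z z′} → (∀ i → ℓ i ≡ ℓ′ i) → z ≡ z′ → parentEdges ℓ z ≡ parentEdges ℓ′ z′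
  parentEdges-cong {ℓ} {ℓ′} {z} ℓ≗ refl = ⊆-antisym (incl ℓ≗) (incl (sym ∘ ℓ≗))
    where
    incl : ∀ {ℓ ℓ′} → (∀ i → ℓ i ≡ ℓ′ i) → ∀ {e} → e ∈ parentEdges ℓ z → e ∈ parentEdges ℓ′ z
    incl {ℓ} {ℓ′} ℓ≗ e∈ with ∈-parentEdges⁻ {ℓ} {z} e∈
    ... | zero  , v∉R , refl = ∈-parentEdges⁺ {ℓ′} v∉R
    ... | suc i , v∉R , refl = subst (_∈ parentEdges ℓ′ z) (cong (proj₁ ∘ rimStep i) (sym (ℓ≗ i))) (∈-parentEdges⁺ {ℓ′} v∉R)

  valid⇒code : ∀ {ℓ z} → Valid ℓ z → ∃[ x ] (x List.∈ codes × parentEdges ℓ z ≡ forestOf x)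
  valid⇒code {ℓ} {z} valid = (stop ∷ v , index z) ,
    ∈-markedFrom⁺ (suc (toℕ i₀)) stop v (index z) chain fits
      (trans (cong rimRooted (trans (lookup-w (index z)) (cong ℓ (vertex-index z)))) hubward) ,
    parentEdges-cong (λ i → sym (trans (lookup-w (index i)) (cong ℓ (vertex-index i)))) (sym (vertex-index z))
    where
    open Valid valid
    v : Vec Letter n
    v = tabulate (ℓ ∘ vertex ∘ suc)
    lookup-w : ∀ j → lookup (stop ∷ v) j ≡ ℓ (vertex j)
    lookup-w zero    = sym (trans (cong (ℓ ∘ position) (+-identityʳ (toℕ i₀)))
      (trans (cong ℓ (position-toℕ i₀)) (root⇒stop i₀∈R)))
    lookup-w (suc j) = lookup∘tabulate (ℓ ∘ vertex ∘ suc) j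
    chain : Chain follows stop v stop
    chain = cyclic⇒chain follows stop v λ j →
      trans (cong₂ follows (lookup-w j) (trans (lookup-w (next j)) (cong ℓ (vertex-next j)))) (following (vertex j))
    isStop-ℓ : ∀ i → isStop (ℓ i) ≡ does (rim i ∈? R)
    isStop-ℓ i with rim i ∈? R
    ... | yes i∈R = cong isStop (root⇒stop i∈R)
    ... | no i∉R with ℓ i in eq
    ...   | stop    = contradiction (stop⇒root eq) i∉R
    ...   | hub     = refl
    ...   | left _  = refl
    ...   | right _ = refl
    fits : Fits (suc (toℕ i₀)) v
    fits k = trans (cong isStop (lookup-w (suc k))) (trans (isStop-ℓ (vertex (suc k)))
      (cong stopAt (+-suc (toℕ i₀) (toℕ k))))

  forest⇒code : ∀ {F} → IsRootedSpanningForest (wheel (suc n)) R F → F List.∈ map forestOf codes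
  forest⇒code {F} forest = let x , x∈ , eq = valid⇒code (letters-valid parentMap) in
    subst (List._∈ map forestOf codes) (trans (sym eq) (parentEdges-letters parentMap)) (∈-map⁺ forestOf x∈)
    where
    parentMap : IsParentMap (wheel (suc n)) R F _ _
    -- The edge `spoke zero` is the default value at roots.
    parentMap = forest⇒parentMap (wheel (suc n)) R F (spoke zero) forest

  𝓕≡length-codes : 𝓕 (wheel (suc n)) R ≡ length codes
  𝓕≡length-codes = #Subsets≡length (isRootedSpanningForest? (wheel (suc n)) R) forestOf
    (unique-markedFrom stop n (suc (toℕ i₀))) forestOf-injective forestOf-forest forest⇒code

corollary3p8 : (N r : ℕ) → 3 ≤ N → 1 ≤ r → r ≤ N →
    (R : Subset (suc N)) (a : Fin r → Fin N) →
    (∀ i j → i Fin.< j → a i Fin.< a j) →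
    (∀ v → (v ∈ R) ⇔ (∃[ i ] v ≡ rim (a i))) →
    let d = cyclicInterval a in
    𝓕 (wheel N) R ≡ ∑ (λ i → m* (C (2 * d i)) * ∏-except i (λ j → m (P (2 * d j ∸ 1))))
corollary3p8 (suc n) (suc r) _ _ _ R a inc R⇔ = begin
  𝓕 (wheel (suc n)) R
    ≡⟨ 𝓕≡length-codes ⟩
  length codes
    ≡⟨ proj₂ (lengths-by-gaps stopAt b E n (+-suc (b zero) n) inc b<E stopAt-b stopAt⇒b) ⟩
  ∑ (λ i → γ (g i ∸ 1) stop * ∏-except i (λ j → α (g j ∸ 1) stop))
    ≡⟨ ∑-cong (λ i → cong₂ _*_ (cycleFactor i) (∏-except-cong i pathFactor)) ⟩
  ∑ (λ i → m* (C (2 * d i)) * ∏-except i (λ j → m (P (2 * d j ∸ 1)))) ∎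
  where
  open ≡-Reasoning
  b d g : Fin (suc r) → ℕ
  b = toℕ ∘ a
  d = cyclicInterval a
  E : ℕ
  -- The first root again, one full turn later.
  E = b zero + suc n
  g = gap b E

  a∈R : ∀ i → rim (a i) ∈ R
  a∈R i = Equivalence.from (R⇔ _) (i , refl)
  centre∉R : zero ∉ R
  centre∉R centre∈R with Equivalence.to (R⇔ zero) centre∈R
  ... | _ , ()

  open ForestCount R centre∉R (a zero) (a∈R zero)
  open Rotation (a zero) using (position; position-toℕ)

  b₀≤b : ∀ i → b zero ≤ b i
  b₀≤b zero    = ≤-refl
  b₀≤b (suc i) = <⇒≤ (inc zero (suc i) (s≤s z≤n))
  b<E : ∀ i → b i < E
  b<E i = ≤-trans (toℕ<n (a i)) (ℕ.m≤n+m (suc n) (b zero))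
  stopAt-b : ∀ i → stopAt (b i) ≡ true
  stopAt-b i = dec-true (rim (position (b i)) ∈? R) (subst (λ j → rim j ∈ R) (sym (position-toℕ (a i))) (a∈R i))
  stopAt⇒b : ∀ s → b zero ≤ s → s < E → stopAt s ≡ true → ∃[ i ] s ≡ b i
  stopAt⇒b s _ s<E stopped with Equivalence.to (R⇔ _) (does-true⁻ (rim (position s) ∈? R) stopped)
  ... | i , eq with s ℕ.<? suc n
  ...   | yes s<N = i , trans (sym (m<n⇒m%n≡m s<N)) s%N≡b
    where
    s%N≡b : s % suc n ≡ b i
    s%N≡b = trans (sym (toℕ-mod s (suc n))) (cong toℕ (Fin.suc-injective eq))
  -- Past the end of the rim, s would stand for a root at t = s - N, which is smaller than the first
  -- root.
  ...   | no s≮N with ℕ.m≤n⇒∃[o]m+o≡n (ℕ.≮⇒≥ s≮N)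
  ...     | t , refl = contradiction (b₀≤b i) (ℕ.<⇒≱ (subst (_< b zero) t≡b t<b₀))
    where
    t<b₀ : t < b zero
    t<b₀ = ℕ.+-cancelˡ-< (suc n) t (b zero) (subst (suc n + t <_) (ℕ.+-comm (b zero) (suc n)) s<E)
    t≡b : t ≡ b i
    t≡b = begin
      t                     ≡⟨ m<n⇒m%n≡m (ℕ.<-trans t<b₀ (toℕ<n (a zero))) ⟨
      t % suc n             ≡⟨ [m+n]%n≡m%n t (suc n) ⟨
      (t + suc n) % suc n   ≡⟨ cong (_% suc n) (ℕ.+-comm t (suc n)) ⟩
      (suc n + t) % suc n   ≡⟨ toℕ-mod (suc n + t) (suc n) ⟨
      toℕ ((suc n + t) mod suc n)   ≡⟨ cong toℕ (Fin.suc-injective eq) ⟩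
      b i                   ∎

  2*d≡ : ∀ i → 2 * d i ≡ suc (suc ((g i ∸ 1) + (g i ∸ 1)))
  -- By `gap>0` an interval is positive, so subtracting 1 and adding 2 after doubling restores 2d.
  2*d≡ i rewrite cyclicInterval≡gap a i with g i | gap>0 b E inc b<E i
  ... | suc k | _ = cong suc (trans (cong (k +_) (cong suc (+-identityʳ k))) (+-suc k k))
  cycleFactor : ∀ i → γ (g i ∸ 1) stop ≡ m* (C (2 * d i))
  cycleFactor i = trans (γ-cycle (g i ∸ 1)) (cong (m* ∘ C) (sym (2*d≡ i)))
  pathFactor : ∀ i → α (g i ∸ 1) stop ≡ m (P (2 * d i ∸ 1))
  pathFactor i = trans (α-path (g i ∸ 1)) (cong (λ k → m (P (k ∸ 1))) (sym (2*d≡ i)))
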